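{- For $n\geq 1$, let $B_n(y,t)=\sum_{\sigma\in\mathcal{B}_n}y^{\mathsf{neg}\,\sigma}t^{\mathsf{des}_B\,\sigma}$. Then $$B_n(y, t)=(1+yt)^nP^{(\mathsf{cpk}, \mathsf{exc})}\left(\mathfrak{S}_n; \frac{(1+y)^2t}{(y+t)(1+yt)}, \frac{y+t}{1+yt}\right),$$ equivalently, $$P^{(\mathsf{cpk},\mathsf{exc})}\left(\mathfrak{S}_n; y,t\right)=\frac{1}{(1+uv)^{n}}B_{n}(u,v),$$ where $u=\frac{1+t^{2}-2yt-(1-t)\sqrt{(1+t)^{2}-4yt}}{2(1-y)t}$ and $v=\frac{(1+t)^{2}-2yt-(1+t)\sqrt{(1+t)^{2}-4yt}}{2yt}$.
   Context: $\mathcal{B}_n$ is the set of permutations $\sigma$ of $\{\pm1,\dots,\pm n\}$ with $\sigma(-i)=-\sigma(i)$; $\mathsf{neg}\,\sigma=\#\{i\in[n]:\sigma(i)<0\}$; $\mathsf{des}_B\,\sigma=\#\{i\in\{0,\dots,n-1\}:\sigma(i)>\sigma(i+1)\}$ with $\sigma(0)=0$ and the natural order. $\mathfrak{S}_n$ is the set of permutations of $[n]$; $P^{(\mathsf{cpk},\mathsf{exc})}(\mathfrak{S}_n;a,b)=\sum_{\sigma\in\mathfrak{S}_n}a^{\mathsf{cpk}\,\sigma}b^{\mathsf{exc}\,\sigma}$, where $\mathsf{exc}\,\sigma=\#\{i:\sigma(i)>i\}$ and $\mathsf{cpk}\,\sigma=\#\{x\in[n]:\sigma^{ -1}(x)<x>\sigma(x)\}$.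 -}

module Defs where

open import Level using (0ℓ; _⊔_)
open import Algebra.Bundles using (CommutativeRing)
import Algebra.Definitions as AlgebraDefinitions
import Algebra.Properties.CommutativeMonoid.Sum as Sum
import Algebra.Properties.Semiring.Exp as Exp
open import Data.Fin.Base using (Fin; zero; suc; toℕ; inject₁; punchIn; punchOut; finToFun; funToFin)
import Data.Fin.Base as Fin
import Data.Fin.Properties as Fin
open import Data.Fin.Patterns using (0F; 1F)
open import Data.Fin.Permutation as Perm
  using (Permutation′; _⟨$⟩ʳ_; _⟨$⟩ˡ_; insert; remove; insert-remove; remove-insert; punchIn-permute)
open import Data.Integer.Base using (ℤ; 0ℤ; _◃_)
import Data.Integer.Properties as ℤ
open import Data.List.Base using (length; filter; allFin)
open import Data.Nat.Base as ℕ using (ℕ; zero; suc)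
open import Data.Product.Base using (_×_; _,_; proj₁; proj₂; ∃-syntax)
open import Data.Product.Function.NonDependent.Setoid using (_×-inverse_)
open import Data.Product.Relation.Binary.Pointwise.NonDependent using (_×ₛ_; Pointwise-≡↔≡)
open import Data.Sign.Base as Sign using (Sign)
import Data.Sign.Properties as Sign
open import Function.Base using (_∘_)
open import Function.Bundles using (Inverse; _↔_; mk↔ₛ′)
import Function.Construct.Composition as Comp
import Function.Construct.Identity as Id
import Function.Construct.Symmetry as Symm
open import Relation.Binary.Bundles using (Setoid)
import Relation.Binary.Construct.On as On
open import Relation.Binary.PropositionalEquality
  using (_≡_; refl; sym; trans; cong; cong₂; setoid; _→-setoid_; module ≡-Reasoning)
open import Relation.Nullary.Decidable using (yes; no; _×-dec_)
open import Relation.Unary using (Pred; Decidable)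

------------------------------------------------------------------------
-- Finite setoids

-- Sums over permutations range over classes of pointwise equal bijections,
-- so finiteness is a bijection between some Fin k and a setoid.
Finite : ∀ {a ℓ} → Setoid a ℓ → Set (a ⊔ ℓ)
Finite S = ∃[ k ] Inverse (setoid (Fin k)) S

_⊗_ : ∀ {a ℓ b m} {S : Setoid a ℓ} {T : Setoid b m} → Finite S → Finite T → Finite (S ×ₛ T)
(j , I) ⊗ (k , J) = _ , Comp.inverse Fin.*↔× (Comp.inverse (Symm.inverse Pointwise-≡↔≡) (I ×-inverse J))

transport : ∀ {a ℓ b m} {S : Setoid a ℓ} {T : Setoid b m} → Inverse S T → Finite S → Finite T
transport I (k , J) = k , Comp.inverse J I

# : ∀ {n p} {P : Pred (Fin n) p} → Decidable P → ℕ
# {n} P? = length (filter P? (allFin n))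

------------------------------------------------------------------------
-- The symmetric group 𝔖ₙ, acting on Fin n

𝔖 : ℕ → Setoid 0ℓ 0ℓ
𝔖 n = On.setoid {B = Permutation′ n} (Fin n →-setoid Fin n) _⟨$⟩ʳ_

exc : ∀ {n} → Permutation′ n → ℕ
exc σ = # λ i → i Fin.<? σ ⟨$⟩ʳ i

cpk : ∀ {n} → Permutation′ n → ℕ
cpk σ = # λ x → (σ ⟨$⟩ˡ x Fin.<? x) ×-dec (σ ⟨$⟩ʳ x Fin.<? x)

insert-cong : ∀ {n} i j {π ρ : Permutation′ n} → π Perm.≈ ρ → insert i j π Perm.≈ insert i j ρ
insert-cong i j π≈ρ k with i Fin.≟ k
... | yes _ = refl
... | no  _ = cong (punchIn j) (π≈ρ _)

remove-cong : ∀ {n} i {π ρ : Permutation′ (suc n)} → π Perm.≈ ρ → remove i π Perm.≈ remove i ρ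
remove-cong i {π} {ρ} π≈ρ j = Fin.punchIn-injective (π ⟨$⟩ʳ i) _ _ (begin
  punchIn (π ⟨$⟩ʳ i) (remove i π ⟨$⟩ʳ j)  ≡⟨ punchIn-permute π i j ⟨
  π ⟨$⟩ʳ punchIn i j                      ≡⟨ π≈ρ _ ⟩
  ρ ⟨$⟩ʳ punchIn i j                      ≡⟨ punchIn-permute ρ i j ⟩
  punchIn (ρ ⟨$⟩ʳ i) (remove i ρ ⟨$⟩ʳ j)  ≡⟨ cong (λ z → punchIn z (remove i ρ ⟨$⟩ʳ j)) (π≈ρ i) ⟨
  punchIn (π ⟨$⟩ʳ i) (remove i ρ ⟨$⟩ʳ j)  ∎)
  where open ≡-Reasoning

𝔖-suc : ∀ n → Inverse (setoid (Fin (suc n)) ×ₛ 𝔖 n) (𝔖 (suc n))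
𝔖-suc n = record
  { to        = λ (j , π) → insert 0F j π
  ; from      = λ σ → σ ⟨$⟩ʳ 0F , remove 0F σ
  ; to-cong   = λ {x} {y} → to-cong {x} {y}
  ; from-cong = λ {σ} {τ} → from-cong {σ} {τ}
  ; inverse   = (λ {σ} {y} y≈ k → trans (to-cong {y} {σ ⟨$⟩ʳ 0F , remove 0F σ} y≈ k) (insert-remove 0F σ k))
              , (λ {(j , π)} {σ} σ≈ → let (p , q) = from-cong {σ} {insert 0F j π} σ≈ in
                   p , λ k → trans (q k) (remove-insert 0F j π k))
  }
  where
  module D = Setoid (setoid (Fin (suc n)) ×ₛ 𝔖 n)

  to-cong : ∀ {x y} → x D.≈ y → insert 0F (proj₁ x) (proj₂ x) Perm.≈ insert 0F (proj₁ y) (proj₂ y)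
  to-cong {j , π} {_ , ρ} (refl , π≈ρ) = insert-cong 0F j {π} {ρ} π≈ρ

  from-cong : ∀ {σ τ : Permutation′ (suc n)} → σ Perm.≈ τ → (σ ⟨$⟩ʳ 0F , remove 0F σ) D.≈ (τ ⟨$⟩ʳ 0F , remove 0F τ)
  from-cong {σ} {τ} σ≈τ = σ≈τ 0F , remove-cong 0F {σ} {τ} σ≈τ

𝔖-finite : ∀ n → Finite (𝔖 n)
𝔖-finite zero = 1 , record
  { to        = λ _ → Perm.id
  ; from      = λ _ → 0F
  ; to-cong   = λ _ ()
  ; from-cong = λ _ → refl
  ; inverse   = (λ _ ()) , λ { {0F} _ → refl }
  }
𝔖-finite (suc n) = transport (𝔖-suc n) ((suc n , Id.inverse _) ⊗ 𝔖-finite n)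

------------------------------------------------------------------------
-- The hyperoctahedral group 𝓑ₙ

-- (s , i) stands for the integer s (i + 1), as i counts from 0.
±[_] : ℕ → Set
±[ n ] = Sign × Fin n

value : ∀ {n} → ±[ n ] → ℤ
value (s , i) = s ◃ suc (toℕ i)

⊖_ : ∀ {n} → ±[ n ] → ±[ n ]
⊖ (s , i) = Sign.opposite s , i

record SignedPermutation (n : ℕ) : Set where
  field
    perm : ±[ n ] ↔ ±[ n ]

  open Inverse perm public using (to; from; strictlyInverseˡ; strictlyInverseʳ)

  field
    odd : ∀ x → to (⊖ x) ≡ ⊖ (to x)

𝓑 : ℕ → Setoid 0ℓ 0ℓ
𝓑 n = On.setoid (±[ n ] →-setoid ±[ n ]) (SignedPermutation.to {n})

-- σ(0), σ(1), …, σ(n), with σ(0) = 0.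
word : ∀ {n} → SignedPermutation n → Fin (suc n) → ℤ
word σ zero    = 0ℤ
word σ (suc i) = value (SignedPermutation.to σ (Sign.+ , i))

neg : ∀ {n} → SignedPermutation n → ℕ
neg σ = # λ i → word σ (suc i) ℤ.<? 0ℤ

desB : ∀ {n} → SignedPermutation n → ℕ
desB σ = # λ i → word σ (suc i) ℤ.<? word σ (inject₁ i)

⊖-involutive : ∀ {n} (x : ±[ n ]) → ⊖ (⊖ x) ≡ x
⊖-involutive (s , i) = cong (_, i) (Sign.opposite-involutive s)

abs-odd : ∀ {n} (f : ±[ n ] → ±[ n ]) → (∀ x → f (⊖ x) ≡ ⊖ (f x)) →
          ∀ s i → f (s , i) ≡ (s Sign.* proj₁ (f (Sign.+ , i)) , proj₂ (f (Sign.+ , i)))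
abs-odd f f-odd Sign.+ i = refl
abs-odd f f-odd Sign.- i = f-odd (Sign.+ , i)

*-square : ∀ s t → s Sign.* t Sign.* t ≡ s
*-square s t = trans (Sign.*-assoc s t t) (trans (cong (s Sign.*_) (Sign.s*s≡+ t)) (Sign.*-identityʳ s))

opposite-* : ∀ s t → Sign.opposite s Sign.* t ≡ Sign.opposite (s Sign.* t)
opposite-* Sign.+ t = refl
opposite-* Sign.- t = sym (Sign.opposite-involutive t)

signedPermutation : ∀ {n} → (Fin n → Sign) → Permutation′ n → SignedPermutation n
signedPermutation ε π = record
  { perm = mk↔ₛ′
      (λ (s , i) → s Sign.* ε i , π ⟨$⟩ʳ i)
      (λ (s , j) → s Sign.* ε (π ⟨$⟩ˡ j) , π ⟨$⟩ˡ j)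
      (λ (s , j) → cong₂ _,_ (*-square s _) (Perm.inverseʳ π))
      (λ (s , i) → cong₂ _,_
        (trans (cong (λ k → s Sign.* ε i Sign.* ε k) (Perm.inverseˡ π)) (*-square s _))
        (Perm.inverseˡ π))
  ; odd = λ (s , i) → cong (_, π ⟨$⟩ʳ i) (opposite-* s (ε i))
  }

signs : ∀ {n} → SignedPermutation n → Fin n → Sign
signs σ i = proj₁ (SignedPermutation.to σ (Sign.+ , i))

∣_∣ : ∀ {n} → SignedPermutation n → Permutation′ n
∣ σ ∣ = Perm.permutation
  (λ i → proj₂ (to (Sign.+ , i)))
  (λ j → proj₂ (from (Sign.+ , j)))
  (λ j → trans (sym (cong proj₂ (abs-odd to odd _ _))) (cong proj₂ (strictlyInverseˡ (Sign.+ , j))))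
  (λ i → trans (sym (cong proj₂ (abs-odd from from-odd _ _))) (cong proj₂ (strictlyInverseʳ (Sign.+ , i))))
  where
  open SignedPermutation σ

  from-odd : ∀ x → from (⊖ x) ≡ ⊖ (from x)
  from-odd x = begin
    from (⊖ x)             ≡⟨ cong (from ∘ ⊖_) (strictlyInverseˡ x) ⟨
    from (⊖ (to (from x))) ≡⟨ cong from (odd (from x)) ⟨
    from (to (⊖ (from x))) ≡⟨ strictlyInverseʳ _ ⟩
    ⊖ (from x)             ∎
    where open ≡-Reasoning

2↔Sign : Fin 2 ↔ Sign
2↔Sign = mk↔ₛ′ (λ { 0F → Sign.+ ; 1F → Sign.- }) (λ { Sign.+ → 0F ; Sign.- → 1F })
  (λ { Sign.+ → refl ; Sign.- → refl }) (λ { 0F → refl ; 1F → refl })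

funToFin-cong : ∀ {m n} {f g : Fin m → Fin n} → (∀ i → f i ≡ g i) → funToFin f ≡ funToFin g
funToFin-cong {zero}  f≗g = refl
funToFin-cong {suc m} f≗g = cong₂ Fin.combine (f≗g zero) (funToFin-cong (f≗g ∘ suc))

𝓑-decomposition : ∀ n → Inverse ((Fin n →-setoid Sign) ×ₛ 𝔖 n) (𝓑 n)
𝓑-decomposition n = record
  { to        = λ (ε , π) → signedPermutation ε π
  ; from      = λ σ → signs σ , ∣ σ ∣
  ; to-cong   = λ (ε≗ , π≈) (s , i) → cong₂ _,_ (cong (s Sign.*_) (ε≗ i)) (π≈ i)
  ; from-cong = λ σ≈ → (λ i → cong proj₁ (σ≈ _)) , (λ i → cong proj₂ (σ≈ _))
  ; inverse   = (λ {σ} (ε≗ , π≈) (s , i) → trans (cong₂ _,_ (cong (s Sign.*_) (ε≗ i)) (π≈ i))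
                   (sym (abs-odd (SignedPermutation.to σ) (SignedPermutation.odd σ) s i)))
              , (λ σ≈ → (λ i → cong proj₁ (σ≈ _)) , (λ i → cong proj₂ (σ≈ _)))
  }

signs-finite : ∀ n → Finite (Fin n →-setoid Sign)
signs-finite n = 2 ℕ.^ n , record
  { to        = λ k i → 2S.to (finToFun {2} {n} k i)
  ; from      = λ ε → funToFin (λ i → 2S.from (ε i))
  ; to-cong   = λ { refl _ → refl }
  ; from-cong = λ ε≗ → funToFin-cong (λ i → cong 2S.from (ε≗ i))
  ; inverse   = (λ { {ε} refl i → trans (cong 2S.to (Fin.finToFun-funToFin _ i)) (2S.strictlyInverseˡ (ε i)) })
              , (λ { {k} ε≗ → trans (funToFin-cong (λ i → trans (cong 2S.from (ε≗ i)) (2S.strictlyInverseʳ _)))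
                                    (Fin.funToFin-finToFin {n} {2} k) })
  }
  where module 2S = Inverse 2↔Sign

𝓑-finite : ∀ n → Finite (𝓑 n)
𝓑-finite n = transport (𝓑-decomposition n) (signs-finite n ⊗ 𝔖-finite n)

------------------------------------------------------------------------
-- Generating polynomials

-- An identity of rational functions is read as an identity between elements
-- of an arbitrary commutative ring in which the denominators are invertible;
-- rational function fields and rings of Laurent series are instances.
module Polynomials {c ℓ} (R : CommutativeRing c ℓ) where

  open CommutativeRing R renaming (refl to ≈-refl; sym to ≈-sym; trans to ≈-trans; setoid to ≈-setoid)
  open Exp semiring public using (_^_)
  open Sum +-commutativeMonoid using (sum)

  Unit : Carrier → Set (c ⊔ ℓ)
  Unit = AlgebraDefinitions.Invertible _≈_ 1# _*_

  infixl 7 _/_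

  _/_ : (x d : Carrier) → ⦃ Unit d ⦄ → Carrier
  _/_ x d ⦃ d⁻¹ , _ ⦄ = x * d⁻¹

  ∑ : ∀ {a r} {S : Setoid a r} → Finite S → (Setoid.Carrier S → Carrier) → Carrier
  ∑ (_ , I) f = sum (f ∘ Inverse.to I)

  P : ℕ → Carrier → Carrier → Carrier
  P n a b = ∑ (𝔖-finite n) λ σ → a ^ cpk σ * b ^ exc σ

  B : ℕ → Carrier → Carrier → Carrier
  B n y t = ∑ (𝓑-finite n) λ σ → y ^ neg σ * t ^ desB σ

  2# 4# : Carrier
  2# = 1# + 1#
  4# = 2# + 2#

{-# OPTIONS --safe #-}

-- Homogenize the descent count by a variable s and put X = (1+y)²st, Y = ys + t, Z = s + yt. The theorem becomes
--   ∑_{σ ∈ 𝓑ₙ} y^neg σ t^des σ s^(n − des σ) = ∑_{π ∈ 𝔖ₙ} X^cpk π Y^(exc π − cpk π) Z^(n − exc π − cpk π).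
-- Inserting ±(n+1) into the word of σ shows that the left side obeys F(n+1) = Z F(n) + ∂F(n), where ∂ is the
-- derivation with ∂s = ∂t = (1+y)st. Since ∂X = X(Y + Z) and ∂Y = ∂Z = X, inserting n+1 into the cycles of π
-- gives the same recurrence on the right. As s and t are elements of an arbitrary ring R, ∂F is read off as the
-- ε-part of F at s + ε∂s and t + ε∂t; hence the induction runs over all rings at once.
module Submission where

open import Defs
open import Level using (Level)
open import Algebra.Bundles using (AbelianGroup; CommutativeRing)
import Algebra.Construct.DirectProduct as DirectProduct
import Algebra.Properties.AbelianGroup as AbelianGroupProperties
import Algebra.Properties.CommutativeMonoid.Sum as Sum
import Algebra.Properties.CommutativeSemiring.Exp as CommutativeExp
import Algebra.Properties.Semiring.Exp as Exp
import Algebra.Properties.Semiring.Mult as Mult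
import Algebra.Properties.Semiring.Sum as SemiringSum
import Algebra.Solver.Ring.NaturalCoefficients.Default as Solver
open import Data.Bool.Base using (true; false; if_then_else_)
open import Data.Fin.Base as Fin using (Fin; zero; suc; toℕ; fromℕ; punchIn; punchOut; inject₁; _↑ˡ_; _↑ʳ_; combine)
import Data.Fin.Properties as Fin
open import Data.Fin.Permutation as Perm
  using (Permutation′; _⟨$⟩ʳ_; _⟨$⟩ˡ_; insert; remove; insert-remove; insert-punchIn; _∘ₚ_; transpose)
import Data.Fin.Permutation.Components as PC
open import Data.Integer.Base as ℤ using (ℤ; 0ℤ; +<+; -<+; -<-)
import Data.Integer.Properties as ℤ
open import Data.List.Base using (length; filter; tabulate)
open import Data.Nat.Base as ℕ using (ℕ; zero; suc; pred; s≤s; z≤n; _≥_)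
import Data.Nat.Properties as ℕ
import Data.Nat.Solver as ℕ
open import Data.Product.Base using (_×_; _,_; proj₁; proj₂)
open import Data.Product.Relation.Binary.Pointwise.NonDependent using (_×ₛ_)
open import Data.Sign.Base as Sign using (Sign)
open import Data.Vec.Functional using (insertAt; removeAt; updateAt; tail)
open import Data.Vec.Functional.Properties
  using (insertAt-lookup; insertAt-punchIn; insertAt-removeAt; updateAt-updates; updateAt-minimal)
open import Function.Base using (_∘_; const)
open import Function.Bundles using (Inverse; Injection)
import Function.Construct.Composition as Comp
import Function.Construct.Identity as Id
import Function.Construct.Symmetry as Symm
open import Function.Properties.Inverse using (↔⇒↣)
open import Relation.Binary.Bundles using (Setoid)
open import Relation.Binary.PropositionalEquality as ≡
  using (_≡_; _≢_; _≗_; _→-setoid_; refl; sym; trans; cong; cong₂; subst; setoid; module ≡-Reasoning)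
open import Relation.Nullary.Decidable using (Dec; yes; no; does; _×-dec_; dec-true; dec-false)
open import Relation.Nullary.Negation using (¬_; contradiction)
open import Relation.Unary using (Pred; Decidable)

open Sum ℕ.+-0-commutativeMonoid using () renaming
  (sum to sumℕ; sum-cong-≗ to sumℕ-cong; sum-remove to sumℕ-remove; sum-permute to sumℕ-permute; ∑-distrib-+ to sumℕ-distrib-+)

-- The variable `s` is what makes ∂ possible: a letter ±(n+1) put into a gap splits ascents as well
-- as descents, so both kinds of step need a variable, and s = 1 is set only at the end. Either
-- split leaves one ascent and one descent, which is why ∂s and ∂t coincide; the place after the
-- last letter splits nothing and accounts for the factor Z. On the cycle side, Y marks a rising
-- edge and Z a falling edge or a loop, in both cases with no cyclic peak at its ends, while X marks
-- the pair of edges around a peak. Splitting an unpaired edge by n+1 creates a peak, whence ∂Y = ∂Z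
-- = X. Splitting one of the two edges at a peak moves the peak to n+1 and leaves one more unpaired
-- edge, falling or rising, whence ∂X = XZ + XY. A new fixed point gives Z. So the largest element
-- is inserted in two ways, into the one-line word and into the cycles, and neither is the way in
-- which `𝔖-finite` enumerates; sums therefore have to be independent of the enumeration.

private variable
  c ℓ ℓ₁ ℓ₂ ℓ₃ ℓ₄ : Level

-- Finite sums over setoids

-- Injectivity yields both the congruence of the section and the remaining inverse law, so an
-- insertion map needs no separate analysis of how removal behaves on equal inputs.
injective∧section⇒inverse : (S : Setoid ℓ₁ ℓ₂) (T : Setoid ℓ₃ ℓ₄) →
  let module S = Setoid S
      module T = Setoid T in
  (f : S.Carrier → T.Carrier) (g : T.Carrier → S.Carrier) →
  (∀ x y → x S.≈ y → f x T.≈ f y) → (∀ x y → f x T.≈ f y → x S.≈ y) →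
  (∀ y → f (g y) T.≈ y) → Inverse S T
injective∧section⇒inverse S T f g f-cong f-injective f∘g = record
  { to        = f
  ; from      = g
  ; to-cong   = λ {x} {y} → f-cong x y
  ; from-cong = λ {x} {y} → g-cong x y
  ; inverse   = (λ {y} {x} x≈ → T.trans (f-cong x (g y) x≈) (f∘g y))
              , (λ {x} {y} y≈ → S.trans (g-cong y (f x) y≈) (f-injective _ _ (f∘g (f x))))
  }
  where
  module S = Setoid S
  module T = Setoid T

  g-cong : ∀ x y → x T.≈ y → g x S.≈ g y
  g-cong x y x≈y = f-injective _ _ (T.trans (f∘g _) (T.trans x≈y (T.sym (f∘g _))))

module FiniteSums (R : CommutativeRing c ℓ) where

  open CommutativeRing R renaming (refl to ≈-refl; sym to ≈-sym; trans to ≈-trans; setoid to ≈-setoid)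
  open Polynomials R using (∑)
  open Sum +-commutativeMonoid public
  open SemiringSum semiring using (*-distribˡ-sum)
  open import Relation.Binary.Reasoning.Setoid ≈-setoid

  sum-↑ : ∀ j {k} (f : Fin (j ℕ.+ k) → Carrier) → sum f ≈ sum (λ i → f (i ↑ˡ k)) + sum (λ i → f (j ↑ʳ i))
  sum-↑ zero    f = ≈-sym (+-identityˡ _)
  sum-↑ (suc j) f = ≈-trans (+-congˡ (sum-↑ j (f ∘ suc))) (≈-sym (+-assoc _ _ _))

  sum-combine : ∀ j {k} (f : Fin (j ℕ.* k) → Carrier) → sum f ≈ sum (λ i → sum (λ l → f (combine {j} i l)))
  sum-combine zero        f = ≈-refl
  sum-combine (suc j) {k} f = ≈-trans (sum-↑ k f) (+-congˡ (sum-combine j (f ∘ (k ↑ʳ_))))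

  ∑-⊗ : {S : Setoid ℓ₁ ℓ₂} {T : Setoid ℓ₃ ℓ₄} (F : Finite S) (G : Finite T) (f : Setoid.Carrier S × Setoid.Carrier T → Carrier) →
        ∑ (F ⊗ G) f ≈ ∑ F λ x → ∑ G λ y → f (x , y)
  ∑-⊗ (j , I) (k , J) f = ≈-trans (sum-combine j _) (sum-cong-≋ {j} λ i → sum-cong-≋ {k} λ l →
    reflexive (≡.cong (λ (i′ , l′) → f (Inverse.to I i′ , Inverse.to J l′)) (Fin.remQuot-combine {j} {k} i l)))

  -- Two enumerations of a setoid differ by a bijection of their index sets. This permits each
  -- recurrence to enumerate permutations and signs by the insertion that suits its statistics.
  ∑-enumeration : {S : Setoid ℓ₁ ℓ₂} (F G : Finite S) {f : Setoid.Carrier S → Carrier} →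
                  (∀ {x y} → Setoid._≈_ S x y → f x ≈ f y) → ∑ F f ≈ ∑ G f
  ∑-enumeration (j , I) (k , J) {f} f-cong = begin
    sum (f ∘ I.to)                    ≈⟨ sum-permute (f ∘ I.to) (Comp.inverse J (Symm.inverse I)) ⟩
    sum (f ∘ I.to ∘ I.from ∘ J.to)    ≈⟨ sum-cong-≋ {k} (λ i → f-cong (I.strictlyInverseˡ (J.to i))) ⟩
    sum (f ∘ J.to)                    ∎
    where
    module I = Inverse I
    module J = Inverse J

  ∑-cong : {S : Setoid ℓ₁ ℓ₂} (F : Finite S) {f g : Setoid.Carrier S → Carrier} → (∀ x → f x ≈ g x) → ∑ F f ≈ ∑ F g
  ∑-cong (k , I) f≈g = sum-cong-≋ {k} (λ i → f≈g (Inverse.to I i))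

  ∑-swap : {S : Setoid ℓ₁ ℓ₂} {T : Setoid ℓ₃ ℓ₄} (F : Finite S) (G : Finite T) (f : Setoid.Carrier S → Setoid.Carrier T → Carrier) →
           ∑ F (λ x → ∑ G λ y → f x y) ≈ ∑ G λ y → ∑ F λ x → f x y
  ∑-swap (_ , I) (_ , J) f = ∑-comm (λ i j → f (Inverse.to I i) (Inverse.to J j))

  ∑-+ : {S : Setoid ℓ₁ ℓ₂} (F : Finite S) (f g : Setoid.Carrier S → Carrier) → ∑ F (λ x → f x + g x) ≈ ∑ F f + ∑ F g
  ∑-+ (_ , I) f g = ∑-distrib-+ (f ∘ Inverse.to I) (g ∘ Inverse.to I)

  ∑-*ˡ : {S : Setoid ℓ₁ ℓ₂} (F : Finite S) (x : Carrier) (f : Setoid.Carrier S → Carrier) → ∑ F (λ y → x * f y) ≈ x * ∑ F f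
  ∑-*ˡ (_ , I) x f = ≈-sym (*-distribˡ-sum x (f ∘ Inverse.to I))

-- Dual numbers and formal differentiation

module DualNumbers (R : CommutativeRing c ℓ) where

  open CommutativeRing R renaming (refl to ≈-refl; sym to ≈-sym; trans to ≈-trans; setoid to ≈-setoid)
  private module Solve = Solver commutativeSemiring
  open Solve using (solve; _:+_; _:*_; _:=_; con)

  private
    open module AG = AbelianGroup (DirectProduct.abelianGroup +-abelianGroup +-abelianGroup)
      using () renaming (_∙_ to _⊞_; ε to 𝟘; _⁻¹ to ⊟_; _≈_ to _≋_)

  infixl 7 _⊠_
  -- A pair `(x , x′)` is x + εx′ with ε² = 0, so the second component is the Leibniz rule.
  _⊠_ : Carrier × Carrier → Carrier × Carrier → Carrier × Carrier
  (x , x′) ⊠ (y , y′) = x * y , x * y′ + x′ * y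

  dual : CommutativeRing c ℓ
  dual = record
    { Carrier = Carrier × Carrier
    ; _≈_ = _≋_
    ; _+_ = _⊞_
    ; _*_ = _⊠_
    ; -_  = ⊟_
    ; 0#  = 𝟘
    ; 1#  = 1# , 0#
    ; isCommutativeRing = record
      { isRing = record
        { +-isAbelianGroup = AG.isAbelianGroup
        ; *-cong = λ (p , p′) (q , q′) → *-cong p q , +-cong (*-cong p q′) (*-cong p′ q)
        ; *-assoc = λ (x , x′) (y , y′) (z , z′) → *-assoc x y z ,
            solve 6 (λ x x′ y y′ z z′ → x :* y :* z′ :+ (x :* y′ :+ x′ :* y) :* z
                                     := x :* (y :* z′ :+ y′ :* z) :+ x′ :* (y :* z)) ≈-refl x x′ y y′ z z′
        ; *-identity =
            (λ (x , x′) → *-identityˡ x ,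
              solve 2 (λ x x′ → con 1 :* x′ :+ con 0 :* x := x′) ≈-refl x x′) ,
            (λ (x , x′) → *-identityʳ x ,
              solve 2 (λ x x′ → x :* con 0 :+ x′ :* con 1 := x′) ≈-refl x x′)
        ; distrib =
            (λ (x , x′) (y , y′) (z , z′) → distribˡ x y z ,
              solve 6 (λ x x′ y y′ z z′ → x :* (y′ :+ z′) :+ x′ :* (y :+ z)
                                       := (x :* y′ :+ x′ :* y) :+ (x :* z′ :+ x′ :* z)) ≈-refl x x′ y y′ z z′) ,
            (λ (x , x′) (y , y′) (z , z′) → distribʳ x y z ,
              solve 6 (λ x x′ y y′ z z′ → (y :+ z) :* x′ :+ (y′ :+ z′) :* x
                                       := (y :* x′ :+ y′ :* x) :+ (z :* x′ :+ z′ :* x)) ≈-refl x x′ y y′ z z′)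
        }
      ; *-comm = λ (x , x′) (y , y′) → *-comm x y ,
          solve 4 (λ x x′ y y′ → x :* y′ :+ x′ :* y := y :* x′ :+ y′ :* x) ≈-refl x x′ y y′
      }
    }

  open Polynomials R using (_^_; ∑)
  open Mult semiring using () renaming (_×_ to _·_)
  module ε where
    open CommutativeRing dual public
    open Polynomials dual public using (_^_; ∑)
    open Sum (CommutativeRing.+-commutativeMonoid dual) public using (sum)

  -- The power rule. At k = 0 the truncated exponent `pred k` is harmless, because its multiplicity
  -- is 0.
  ^-dual : ∀ x x′ k → (x , x′) ε.^ k ≋ (x ^ k , k · (x ^ pred k * x′))
  ^-dual x x′ zero    = ≈-refl , ≈-refl
  ^-dual x x′ (suc k) = ε.trans (ε.*-congˡ {x , x′} (^-dual x x′ k)) (≈-refl , snd k)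
    where
    open import Relation.Binary.Reasoning.Setoid ≈-setoid
    open Mult semiring using (×-comm-*; ×-congʳ)
    snd : ∀ k → x * (k · (x ^ pred k * x′)) + x′ * x ^ k ≈ suc k · (x ^ k * x′)
    snd zero    = solve 2 (λ x x′ → x :* con 0 :+ x′ :* con 1 := con 1 :* x′ :+ con 0) ≈-refl x x′
    snd (suc k) = begin
      x * (suc k · (x ^ k * x′)) + x′ * x ^ suc k   ≈⟨ +-cong (≈-trans (×-comm-* (suc k) x _) (×-congʳ (suc k) (≈-sym (*-assoc _ _ _)))) (*-comm _ _) ⟩
      suc k · (x ^ suc k * x′) + x ^ suc k * x′     ≈⟨ +-comm _ _ ⟩
      suc (suc k) · (x ^ suc k * x′)                ∎

  open FiniteSums R using (sum)

  proj₂-sum : ∀ {n} (f : Fin n → Carrier × Carrier) → proj₂ (ε.sum f) ≡ sum (proj₂ ∘ f)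
  proj₂-sum {zero}  f = refl
  proj₂-sum {suc n} f = ≡.cong (_ +_) (proj₂-sum (f ∘ suc))

  proj₂-∑ : {S : Setoid ℓ₁ ℓ₂} (F : Finite S) (f : Setoid.Carrier S → Carrier × Carrier) → proj₂ (ε.∑ F f) ≡ ∑ F (proj₂ ∘ f)
  proj₂-∑ (_ , I) f = proj₂-sum (f ∘ Inverse.to I)

-- Counting by sums of indicators

ind : ∀ {p} {P : Set p} → Dec P → ℕ
ind P? = if does P? then 1 else 0

module _ {p} {P : Set p} (P? : Dec P) where

  ind-yes : P → ind P? ≡ 1
  ind-yes p = cong (if_then 1 else 0) (dec-true P? p)

  ind-no : ¬ P → ind P? ≡ 0
  ind-no ¬p = cong (if_then 1 else 0) (dec-false P? ¬p)

  ind-⇔ : ∀ {q} {Q : Set q} (Q? : Dec Q) → (P → Q) → (Q → P) → ind P? ≡ ind Q?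
  ind-⇔ (yes q) to from = ind-yes (from q)
  ind-⇔ (no ¬q) to from = ind-no (¬q ∘ to)

#-sum : ∀ {n p} {P : Pred (Fin n) p} (P? : Decidable P) → # P? ≡ sumℕ (λ i → ind (P? i))
#-sum {n} P? = length-filter-tabulate P? (λ i → i)
  where
  length-filter-tabulate : ∀ {a p} {A : Set a} {P : Pred A p} (P? : Decidable P) {n} (f : Fin n → A) →
                           length (filter P? (tabulate f)) ≡ sumℕ (λ i → ind (P? (f i)))
  length-filter-tabulate P? {zero}  f = refl
  length-filter-tabulate P? {suc n} f with does (P? (f zero))
  ... | true  = cong suc (length-filter-tabulate P? (f ∘ suc))
  ... | false = length-filter-tabulate P? (f ∘ suc)

-- Only the terms at `w` differ; adding each of them to the opposite side avoids truncated
-- subtraction.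
sum-except : ∀ {n} (f g : Fin n → ℕ) w → (∀ z → z ≢ w → f z ≡ g z) → sumℕ f ℕ.+ g w ≡ sumℕ g ℕ.+ f w
sum-except {suc n} f g w f≡g = begin
  sumℕ f ℕ.+ g w                           ≡⟨ cong (ℕ._+ g w) (sumℕ-remove f) ⟩
  f w ℕ.+ sumℕ (f ∘ punchIn w) ℕ.+ g w     ≡⟨ cong (λ s → f w ℕ.+ s ℕ.+ g w) (sumℕ-cong λ i → f≡g _ (Fin.punchInᵢ≢i w i)) ⟩
  f w ℕ.+ sumℕ (g ∘ punchIn w) ℕ.+ g w     ≡⟨ ℕ.+-comm _ (g w) ⟩
  g w ℕ.+ (f w ℕ.+ sumℕ (g ∘ punchIn w))   ≡⟨ cong (g w ℕ.+_) (ℕ.+-comm (f w) _) ⟩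
  g w ℕ.+ (sumℕ (g ∘ punchIn w) ℕ.+ f w)   ≡⟨ ℕ.+-assoc (g w) _ _ ⟨
  g w ℕ.+ sumℕ (g ∘ punchIn w) ℕ.+ f w     ≡⟨ cong (ℕ._+ f w) (sumℕ-remove g) ⟨
  sumℕ g ℕ.+ f w                           ∎
  where open ≡-Reasoning

-- Serves for the new maximum placed between `w` and `x`, neither of which can then remain a cyclic
-- peak. If the two coincide, `g x` and `g w` are the same term counted twice, so that term has to
-- be 0.
sum-vanish : ∀ {n} (f g : Fin n → ℕ) x w → f x ≡ 0 → f w ≡ 0 → (x ≡ w → g x ≡ 0) →
             (∀ z → z ≢ x → z ≢ w → f z ≡ g z) → sumℕ f ℕ.+ (g x ℕ.+ g w) ≡ sumℕ g
sum-vanish f g x w fx fw gx f≡g with x Fin.≟ w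
... | yes refl = begin
  sumℕ f ℕ.+ (g x ℕ.+ g x)   ≡⟨ cong (λ v → sumℕ f ℕ.+ (v ℕ.+ g x)) (gx refl) ⟩
  sumℕ f ℕ.+ g x    ≡⟨ sum-except f g x (λ z z≢x → f≡g z z≢x z≢x) ⟩
  sumℕ g ℕ.+ f x    ≡⟨ cong (sumℕ g ℕ.+_) fx ⟩
  sumℕ g ℕ.+ 0      ≡⟨ ℕ.+-identityʳ _ ⟩
  sumℕ g            ∎
  where open ≡-Reasoning
... | no x≢w = begin
  sumℕ f ℕ.+ (g x ℕ.+ g w)   ≡⟨ cong (sumℕ f ℕ.+_) (ℕ.+-comm (g x) _) ⟩
  sumℕ f ℕ.+ (g w ℕ.+ g x)   ≡⟨ ℕ.+-assoc (sumℕ f) _ _ ⟨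
  sumℕ f ℕ.+ g w ℕ.+ g x     ≡⟨ cong (λ v → sumℕ f ℕ.+ v ℕ.+ g x) (updateAt-minimal w x g (x≢w ∘ sym)) ⟨
  sumℕ f ℕ.+ h w ℕ.+ g x     ≡⟨ cong (ℕ._+ g x) (sum-except f h w f≡h) ⟩
  sumℕ h ℕ.+ f w ℕ.+ g x     ≡⟨ cong (λ v → sumℕ h ℕ.+ v ℕ.+ g x) fw ⟩
  sumℕ h ℕ.+ 0 ℕ.+ g x       ≡⟨ cong (ℕ._+ g x) (ℕ.+-identityʳ _) ⟩
  sumℕ h ℕ.+ g x             ≡⟨ sum-except h g x (λ z z≢x → updateAt-minimal z x g z≢x) ⟩
  sumℕ g ℕ.+ h x             ≡⟨ cong (sumℕ g ℕ.+_) (updateAt-updates x g) ⟩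
  sumℕ g ℕ.+ 0               ≡⟨ ℕ.+-identityʳ _ ⟩
  sumℕ g                     ∎
  where
  open ≡-Reasoning
  -- `h` agrees with `f` away from `w` and with `g` away from `x`, so `sum-except` applies once for
  -- each point.
  h = updateAt g x (const 0)
  f≡h : ∀ z → z ≢ w → f z ≡ h z
  f≡h z z≢w with z Fin.≟ x
  ... | yes refl = trans fx (sym (updateAt-updates x g))
  ... | no z≢x   = trans (f≡g z z≢x z≢w) (sym (updateAt-minimal z x g z≢x))

-- Adjoining a largest element

top : ∀ {n} → Fin (suc n)
top {n} = fromℕ n

ι : ∀ {n} → Fin n → Fin (suc n)
ι = punchIn top

toℕ-ι : ∀ {n} (i : Fin n) → toℕ (ι i) ≡ toℕ i
toℕ-ι zero    = refl
toℕ-ι (suc i) = cong suc (toℕ-ι i)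

ι<top : ∀ {n} (i : Fin n) → ι i Fin.< top {n}
ι<top zero    = s≤s z≤n
ι<top (suc i) = s≤s (ι<top i)

ι-mono-< : ∀ {n} {i j : Fin n} → i Fin.< j → ι i Fin.< ι j
ι-mono-< {i = i} {j} i<j rewrite toℕ-ι i | toℕ-ι j = i<j

ι-cancel-< : ∀ {n} {i j : Fin n} → ι i Fin.< ι j → i Fin.< j
ι-cancel-< {i = i} {j} i<j rewrite toℕ-ι i | toℕ-ι j = i<j

top≮ : ∀ {n} (i : Fin (suc n)) → ¬ top Fin.< i
top≮ i top<i = ℕ.<⇒≱ top<i (Fin.≤fromℕ i)

permutation-injective : ∀ {n} (σ : Permutation′ n) {i j} → σ ⟨$⟩ʳ i ≡ σ ⟨$⟩ʳ j → i ≡ j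
permutation-injective σ = Injection.injective (↔⇒↣ σ)

to⇒from : ∀ {n} (σ : Permutation′ n) {i j} → σ ⟨$⟩ʳ i ≡ j → σ ⟨$⟩ˡ j ≡ i
to⇒from σ refl = Perm.inverseˡ σ

from-cong : ∀ {n} {σ τ : Permutation′ n} → σ Perm.≈ τ → ∀ j → σ ⟨$⟩ˡ j ≡ τ ⟨$⟩ˡ j
from-cong {σ = σ} {τ} σ≈τ j = to⇒from σ (trans (σ≈τ _) (Perm.inverseʳ τ))

insert-at : ∀ {n} (i j : Fin (suc n)) (π : Permutation′ n) → insert i j π ⟨$⟩ʳ i ≡ j
insert-at i j π with i Fin.≟ i
... | yes _  = refl
... | no i≢i = contradiction refl i≢i

insert-injective : ∀ {n} (i j : Fin (suc n)) (π ρ : Permutation′ n) → insert i j π Perm.≈ insert i j ρ → π Perm.≈ ρ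
insert-injective i j π ρ eq k = Fin.punchIn-injective j _ _
  (trans (sym (insert-punchIn i j π k)) (trans (eq (punchIn i k)) (insert-punchIn i j ρ k)))

transpose-left : ∀ {n} (i j : Fin n) → transpose i j ⟨$⟩ʳ i ≡ j
transpose-left i j with i Fin.≟ i
... | yes _  = refl
... | no i≢i = contradiction refl i≢i

transpose-right : ∀ {n} (i j : Fin n) → transpose i j ⟨$⟩ʳ j ≡ i
transpose-right i j with j Fin.≟ i
... | yes j≡i = j≡i
... | no _ with j Fin.≟ j
...   | yes _  = refl
...   | no j≢j = contradiction refl j≢j

transpose-other : ∀ {n} (i j : Fin n) {k} → k ≢ i → k ≢ j → transpose i j ⟨$⟩ʳ k ≡ k
transpose-other i j {k} k≢i k≢j with k Fin.≟ i
... | yes k≡i = contradiction k≡i k≢i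
... | no _ with k Fin.≟ j
...   | yes k≡j = contradiction k≡j k≢j
...   | no _    = refl

-- insertBefore x π puts the new largest element just before x in the cycle of x,
-- and makes it a fixed point if x is the new element itself.
insertBefore : ∀ {n} → Fin (suc n) → Permutation′ n → Permutation′ (suc n)
insertBefore x π = insert top top π ∘ₚ transpose top x

module _ {n} (x : Fin (suc n)) (π : Permutation′ n) where

  insertBefore-top : insertBefore x π ⟨$⟩ʳ top ≡ x
  insertBefore-top = trans (cong (transpose top x ⟨$⟩ʳ_) (insert-at top top π)) (transpose-left top x)

  insertBefore-pre : ∀ {z} → ι (π ⟨$⟩ʳ z) ≡ x → insertBefore x π ⟨$⟩ʳ ι z ≡ top
  insertBefore-pre {z} eq = trans (cong (transpose top x ⟨$⟩ʳ_) (trans (insert-punchIn top top π z) eq)) (transpose-right top x)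

  insertBefore-other : ∀ {z} → ι (π ⟨$⟩ʳ z) ≢ x → insertBefore x π ⟨$⟩ʳ ι z ≡ ι (π ⟨$⟩ʳ z)
  insertBefore-other {z} ≢x = trans (cong (transpose top x ⟨$⟩ʳ_) (insert-punchIn top top π z))
    (transpose-other top x (Fin.punchInᵢ≢i top _) ≢x)

insertBefore-injective : ∀ {n} x y (π ρ : Permutation′ n) → insertBefore x π Perm.≈ insertBefore y ρ → x ≡ y × π Perm.≈ ρ
insertBefore-injective x y π ρ eq with trans (sym (insertBefore-top x π)) (trans (eq top) (insertBefore-top y ρ))
... | refl = refl , insert-injective top top π ρ (λ k → permutation-injective (transpose top x) (eq k))

removeTop : ∀ {n} → Permutation′ (suc n) → Permutation′ n
removeTop σ = remove top (σ ∘ₚ transpose (σ ⟨$⟩ʳ top) top)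

insertBefore-removeTop : ∀ {n} (σ : Permutation′ (suc n)) → insertBefore (σ ⟨$⟩ʳ top) (removeTop σ) Perm.≈ σ
insertBefore-removeTop σ k = trans
  (cong (transpose top x ⟨$⟩ʳ_) (trans
    -- `insert-remove` reinserts the value `ρ ⟨$⟩ʳ top`, which is `top` because the swap in `ρ` has
    -- made it a fixed point.
    (cong (λ j → insert top j (remove top ρ) ⟨$⟩ʳ k) (sym (transpose-left x top)))
    (insert-remove top ρ k)))
  (PC.transpose-inverse top x)
  where
  x = σ ⟨$⟩ʳ top
  ρ = σ ∘ₚ transpose x top

insertBefore-cong : ∀ {n} x {π ρ : Permutation′ n} → π Perm.≈ ρ → insertBefore x π Perm.≈ insertBefore x ρ
insertBefore-cong x {π} {ρ} π≈ρ k = cong (transpose top x ⟨$⟩ʳ_) (insert-cong top top {π} {ρ} π≈ρ k)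

insertBefore-inverse : ∀ n → Inverse (setoid (Fin (suc n)) ×ₛ 𝔖 n) (𝔖 (suc n))
insertBefore-inverse n = injective∧section⇒inverse (setoid (Fin (suc n)) ×ₛ 𝔖 n) (𝔖 (suc n))
  (λ (x , π) → insertBefore x π)
  (λ σ → σ ⟨$⟩ʳ top , removeTop σ)
  (λ { (x , π) (_ , ρ) (refl , π≈ρ) → insertBefore-cong x {π} {ρ} π≈ρ })
  (λ (x , π) (y , ρ) → insertBefore-injective x y π ρ)
  insertBefore-removeTop

-- Cyclic peaks and excedances

peak? : ∀ {n} (σ : Permutation′ n) x → Dec (σ ⟨$⟩ˡ x Fin.< x × σ ⟨$⟩ʳ x Fin.< x)
peak? σ x = (σ ⟨$⟩ˡ x Fin.<? x) ×-dec (σ ⟨$⟩ʳ x Fin.<? x)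

rise? : ∀ {n} (σ : Permutation′ n) x → Dec (σ ⟨$⟩ˡ x Fin.< x)
rise? σ x = σ ⟨$⟩ˡ x Fin.<? x

module _ {n} {σ τ : Permutation′ n} (σ≈τ : σ Perm.≈ τ) where

  cpk-cong : cpk σ ≡ cpk τ
  cpk-cong = trans (#-sum (peak? σ)) (trans
    (sumℕ-cong λ x → ind-⇔ (peak? σ x) (peak? τ x)
      (λ (l , r) → subst (Fin._< x) (from-cong {σ = σ} {τ} σ≈τ x) l , subst (Fin._< x) (σ≈τ x) r)
      (λ (l , r) → subst (Fin._< x) (sym (from-cong {σ = σ} {τ} σ≈τ x)) l , subst (Fin._< x) (sym (σ≈τ x)) r))
    (sym (#-sum (peak? τ))))

  exc-cong : exc σ ≡ exc τ
  exc-cong = trans (#-sum λ i → i Fin.<? σ ⟨$⟩ʳ i) (trans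
    (sumℕ-cong λ i → cong (λ j → ind (i Fin.<? j)) (σ≈τ i))
    (sym (#-sum λ i → i Fin.<? τ ⟨$⟩ʳ i)))

module _ {n} (π : Permutation′ n) where

  private
    e : Fin n → ℕ
    e i = ind (i Fin.<? π ⟨$⟩ʳ i)

    p : Fin n → ℕ
    p x = ind (peak? π x)

    exc-top : (σ : Permutation′ (suc n)) → exc σ ≡ sumℕ (λ z → ind (ι z Fin.<? σ ⟨$⟩ʳ ι z))
    exc-top σ = trans (#-sum λ i → i Fin.<? σ ⟨$⟩ʳ i) (trans (sumℕ-remove {i = top} (λ i → ind (i Fin.<? σ ⟨$⟩ʳ i)))
      (cong (ℕ._+ sumℕ (λ z → ind (ι z Fin.<? σ ⟨$⟩ʳ ι z))) (ind-no (top Fin.<? σ ⟨$⟩ʳ top) (top≮ (σ ⟨$⟩ʳ top)))))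

    cpk-top : (σ : Permutation′ (suc n)) → cpk σ ≡ ind (peak? σ top) ℕ.+ sumℕ (λ z → ind (peak? σ (ι z)))
    cpk-top σ = trans (#-sum (peak? σ)) (sumℕ-remove {i = top} (λ x → ind (peak? σ x)))

    -- Being a cyclic peak depends only on the two neighbours in the cycle, and the insertion alters
    -- only the edge into `x`; the hypotheses keep that edge away from `z`.
    unchanged : ∀ x z → ι z ≢ x → ι (π ⟨$⟩ʳ z) ≢ x → ind (peak? (insertBefore x π) (ι z)) ≡ p z
    unchanged x z z≢x πz≢x
      rewrite insertBefore-other x π πz≢x
            | to⇒from (insertBefore x π) {ι (π ⟨$⟩ˡ z)} {ι z} (trans
                (insertBefore-other x π (λ eq → z≢x (trans (cong ι (sym (Perm.inverseʳ π))) eq)))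
                (cong ι (Perm.inverseʳ π)))
      = ind-⇔ ((ι (π ⟨$⟩ˡ z) Fin.<? ι z) ×-dec (ι (π ⟨$⟩ʳ z) Fin.<? ι z)) (peak? π z)
          (λ (l , r) → ι-cancel-< l , ι-cancel-< r) (λ (l , r) → ι-mono-< l , ι-mono-< r)

  exc-insertBefore-top : exc (insertBefore top π) ≡ exc π
  exc-insertBefore-top = trans (exc-top (insertBefore top π)) (trans
    (sumℕ-cong λ z → trans (cong (λ j → ind (ι z Fin.<? j)) (insertBefore-other top π (Fin.punchInᵢ≢i top _)))
      (ind-⇔ (ι z Fin.<? ι (π ⟨$⟩ʳ z)) (z Fin.<? π ⟨$⟩ʳ z) ι-cancel-< ι-mono-<))
    (sym (#-sum λ i → i Fin.<? π ⟨$⟩ʳ i)))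

  cpk-insertBefore-top : cpk (insertBefore top π) ≡ cpk π
  cpk-insertBefore-top = trans (cpk-top (insertBefore top π)) (trans (cong₂ ℕ._+_
      (ind-no (peak? (insertBefore top π) top) (λ (_ , r) → top≮ top (subst (Fin._< top) (insertBefore-top top π) r)))
      (sumℕ-cong λ z → unchanged top z (Fin.punchInᵢ≢i top _) (Fin.punchInᵢ≢i top _)))
    (sym (#-sum (peak? π))))

  module _ (x : Fin n) where

    private
      σ = insertBefore (ι x) π
      w = π ⟨$⟩ˡ x

      σw≡top : σ ⟨$⟩ʳ ι w ≡ top
      σw≡top = insertBefore-pre (ι x) π (cong ι (Perm.inverseʳ π))

      away : ∀ z → z ≢ w → ι (π ⟨$⟩ʳ z) ≢ ι x
      away z z≢w eq = z≢w (sym (to⇒from π (Fin.punchIn-injective top _ _ eq)))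

    -- The edge w → x becomes w → top → x. The first half always rises and the second never does, so
    -- one excedance is gained and the one of w → x, if it rose, is lost.
    exc-insertBefore : exc σ ℕ.+ ind (rise? π x) ≡ suc (exc π)
    exc-insertBefore = begin
      exc σ ℕ.+ ind (rise? π x)   ≡⟨ cong₂ ℕ._+_ (exc-top σ) (cong (λ j → ind (w Fin.<? j)) (sym (Perm.inverseʳ π))) ⟩
      sumℕ e′ ℕ.+ e w              ≡⟨ sum-except e′ e w e′≡e ⟩
      sumℕ e ℕ.+ e′ w              ≡⟨ cong₂ ℕ._+_ (sym (#-sum λ i → i Fin.<? π ⟨$⟩ʳ i)) (ind-yes (_ Fin.<? _) (subst (ι w Fin.<_) (sym σw≡top) (ι<top w))) ⟩
      exc π ℕ.+ 1                 ≡⟨ ℕ.+-comm _ 1 ⟩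
      suc (exc π)                 ∎
      where
      open ≡-Reasoning
      e′ : Fin n → ℕ
      e′ z = ind (ι z Fin.<? σ ⟨$⟩ʳ ι z)
      e′≡e : ∀ z → z ≢ w → e′ z ≡ e z
      e′≡e z z≢w = trans (cong (λ j → ind (ι z Fin.<? j)) (insertBefore-other (ι x) π (away z z≢w)))
        (ind-⇔ (ι z Fin.<? ι (π ⟨$⟩ʳ z)) (z Fin.<? π ⟨$⟩ʳ z) ι-cancel-< ι-mono-<)

    -- The new maximum is a peak. Since it now precedes `x` and follows `w`, neither of these is a
    -- peak any more; all other elements keep their neighbours.
    cpk-insertBefore : cpk σ ℕ.+ (ind (peak? π x) ℕ.+ ind (peak? π (π ⟨$⟩ˡ x))) ≡ suc (cpk π)
    cpk-insertBefore = begin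
      cpk σ ℕ.+ (p x ℕ.+ p w)                                ≡⟨ cong (ℕ._+ (p x ℕ.+ p w)) (cpk-top σ) ⟩
      ind (peak? σ top) ℕ.+ sumℕ p′ ℕ.+ (p x ℕ.+ p w)         ≡⟨ cong (λ v → v ℕ.+ sumℕ p′ ℕ.+ (p x ℕ.+ p w)) (ind-yes (peak? σ top) peak-top) ⟩
      suc (sumℕ p′ ℕ.+ (p x ℕ.+ p w))                         ≡⟨ cong suc (sum-vanish p′ p x w p′x p′w fixed λ z z≢x z≢w →
                                                                  unchanged (ι x) z (λ eq → z≢x (Fin.punchIn-injective top _ _ eq)) (away z z≢w)) ⟩
      suc (sumℕ p)                                            ≡⟨ cong suc (#-sum (peak? π)) ⟨
      suc (cpk π)                                            ∎
      where
      open ≡-Reasoning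
      p′ : Fin n → ℕ
      p′ z = ind (peak? σ (ι z))
      peak-top : σ ⟨$⟩ˡ top Fin.< top × σ ⟨$⟩ʳ top Fin.< top
      peak-top = subst (Fin._< top) (sym (to⇒from σ σw≡top)) (ι<top w)
               , subst (Fin._< top) (sym (insertBefore-top (ι x) π)) (ι<top x)
      p′x : p′ x ≡ 0
      p′x = ind-no (peak? σ (ι x)) λ (l , _) → top≮ (ι x) (subst (Fin._< ι x) (to⇒from σ (insertBefore-top (ι x) π)) l)
      p′w : p′ w ≡ 0
      p′w = ind-no (peak? σ (ι w)) λ (_ , r) → top≮ (ι w) (subst (Fin._< ι w) σw≡top r)
      -- Here `x` is a fixed point of `π`, hence not a peak, and nothing is counted twice.
      fixed : x ≡ w → p x ≡ 0
      fixed x≡w = ind-no (peak? π x) λ (l , _) → Fin.<⇒≢ l (sym x≡w)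

-- The kinds of edges σ⁻¹(x) → x of a cycle: rising or not, adjacent to a cyclic peak or not.
data Edge : Set where
  ↑peak ↑ peak↓ ↓ : Edge

δ : Edge → Edge → ℕ
δ ↑peak ↑peak = 1
δ ↑     ↑     = 1
δ peak↓ peak↓ = 1
δ ↓     ↓     = 1
δ _     _     = 0

δ-refl : ∀ k → δ k k ≡ 1
δ-refl ↑peak = refl
δ-refl ↑     = refl
δ-refl peak↓ = refl
δ-refl ↓     = refl

δ-total : ∀ k → δ ↑peak k ℕ.+ δ ↑ k ℕ.+ (δ peak↓ k ℕ.+ δ ↓ k) ≡ 1
δ-total ↑peak = refl
δ-total ↑     = refl
δ-total peak↓ = refl
δ-total ↓     = refl

module _ {p q r} {P : Set p} {Q : Set q} {R : Set r} where

  -- To be read with `P`: the edge rises, `Q`: its target is a peak, `R`: its source is a peak. As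
  -- `Q` forces `P` and `R` excludes it, exactly the four kinds can occur. A fixed point counts as
  -- `↓`.
  classify : Dec P → Dec Q → Dec R → Edge
  classify (yes _) (yes _) _       = ↑peak
  classify (yes _) (no _)  _       = ↑
  classify (no _)  _       (yes _) = peak↓
  classify (no _)  _       (no _)  = ↓

  classify-rise : ∀ P? Q? R? → ind P? ≡ δ ↑peak (classify P? Q? R?) ℕ.+ δ ↑ (classify P? Q? R?)
  classify-rise (yes _) (yes _) _       = refl
  classify-rise (yes _) (no _)  _       = refl
  classify-rise (no _)  _       (yes _) = refl
  classify-rise (no _)  _       (no _)  = refl

  classify-↑peak : (Q → P) → ∀ P? Q? R? → ind Q? ≡ δ ↑peak (classify P? Q? R?)
  classify-↑peak Q⇒P (yes _) (yes _) _       = refl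
  classify-↑peak Q⇒P (yes _) (no _)  _       = refl
  classify-↑peak Q⇒P (no ¬p) (yes q) _       = contradiction (Q⇒P q) ¬p
  classify-↑peak Q⇒P (no _)  (no _)  (yes _) = refl
  classify-↑peak Q⇒P (no _)  (no _)  (no _)  = refl

  classify-peak↓ : (R → ¬ P) → ∀ P? Q? R? → ind R? ≡ δ peak↓ (classify P? Q? R?)
  classify-peak↓ R⇒¬P (yes p) _       (yes r) = contradiction p (R⇒¬P r)
  classify-peak↓ R⇒¬P (yes _) (yes _) (no _)  = refl
  classify-peak↓ R⇒¬P (yes _) (no _)  (no _)  = refl
  classify-peak↓ R⇒¬P (no _)  _       (yes _) = refl
  classify-peak↓ R⇒¬P (no _)  _       (no _)  = refl

module _ {n} (π : Permutation′ n) where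

  edge : Fin n → Edge
  edge x = classify (rise? π x) (peak? π x) (peak? π (π ⟨$⟩ˡ x))

  δ-rise : ∀ x → ind (rise? π x) ≡ δ ↑peak (edge x) ℕ.+ δ ↑ (edge x)
  δ-rise x = classify-rise (rise? π x) (peak? π x) (peak? π (π ⟨$⟩ˡ x))

  δ-↑peak : ∀ x → ind (peak? π x) ≡ δ ↑peak (edge x)
  δ-↑peak x = classify-↑peak proj₁ (rise? π x) (peak? π x) (peak? π (π ⟨$⟩ˡ x))

  δ-peak↓ : ∀ x → ind (peak? π (π ⟨$⟩ˡ x)) ≡ δ peak↓ (edge x)
  δ-peak↓ x = classify-peak↓ (λ (_ , f) → ℕ.<⇒≯ (subst (Fin._< π ⟨$⟩ˡ x) (Perm.inverseʳ π) f))
    (rise? π x) (peak? π x) (peak? π (π ⟨$⟩ˡ x))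

  count : Edge → ℕ
  count k = sumℕ (λ x → δ k (edge x))

  cpk-↑peak : cpk π ≡ count ↑peak
  cpk-↑peak = trans (#-sum (peak? π)) (sumℕ-cong δ-↑peak)

  -- Every peak has one incoming and one outgoing edge. Reindexing along `π` charges it to the
  -- outgoing one, where `cpk-↑peak` charges it to the incoming one.
  cpk-peak↓ : cpk π ≡ count peak↓
  cpk-peak↓ = trans (#-sum (peak? π)) (trans (sumℕ-permute (λ x → ind (peak? π x)) (Perm.flip π)) (sumℕ-cong δ-peak↓))

  -- An excedance is the source of a rising edge; reindexing by targets separates the rising edges
  -- that enter a peak, one for each peak, from the others.
  exc-count : exc π ≡ cpk π ℕ.+ count ↑
  exc-count = begin
    exc π                                                ≡⟨ #-sum (λ i → i Fin.<? π ⟨$⟩ʳ i) ⟩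
    sumℕ (λ i → ind (i Fin.<? π ⟨$⟩ʳ i))                  ≡⟨ sumℕ-permute (λ i → ind (i Fin.<? π ⟨$⟩ʳ i)) (Perm.flip π) ⟩
    sumℕ (λ x → ind (π ⟨$⟩ˡ x Fin.<? π ⟨$⟩ʳ (π ⟨$⟩ˡ x)))  ≡⟨ sumℕ-cong (λ x → cong (λ y → ind (π ⟨$⟩ˡ x Fin.<? y)) (Perm.inverseʳ π)) ⟩
    sumℕ (λ x → ind (rise? π x))                          ≡⟨ sumℕ-cong δ-rise ⟩
    sumℕ (λ x → δ ↑peak (edge x) ℕ.+ δ ↑ (edge x))        ≡⟨ sumℕ-distrib-+ (λ x → δ ↑peak (edge x)) _ ⟩
    count ↑peak ℕ.+ count ↑                              ≡⟨ cong (ℕ._+ count ↑) cpk-↑peak ⟨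
    cpk π ℕ.+ count ↑                                    ∎
    where open ≡-Reasoning

  -- Each element has one incoming edge. Together with `exc-count` this identifies `count ↓` with n
  -- - exc π - cpk π.
  size-count : n ≡ cpk π ℕ.+ count ↑ ℕ.+ (cpk π ℕ.+ count ↓)
  size-count = begin
    n                                                                  ≡⟨ sum-ones n ⟨
    sumℕ {n} (λ _ → 1)                                                  ≡⟨ sumℕ-cong (λ x → δ-total (edge x)) ⟨
    sumℕ (λ x → δ ↑peak (edge x) ℕ.+ δ ↑ (edge x) ℕ.+ (δ peak↓ (edge x) ℕ.+ δ ↓ (edge x)))
      ≡⟨ sumℕ-distrib-+ (λ x → δ ↑peak (edge x) ℕ.+ δ ↑ (edge x)) _ ⟩
    sumℕ (λ x → δ ↑peak (edge x) ℕ.+ δ ↑ (edge x)) ℕ.+ sumℕ (λ x → δ peak↓ (edge x) ℕ.+ δ ↓ (edge x))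
      ≡⟨ cong₂ ℕ._+_ (sumℕ-distrib-+ (λ x → δ ↑peak (edge x)) _) (sumℕ-distrib-+ (λ x → δ peak↓ (edge x)) _) ⟩
    count ↑peak ℕ.+ count ↑ ℕ.+ (count peak↓ ℕ.+ count ↓)              ≡⟨ cong₂ (λ a b → a ℕ.+ count ↑ ℕ.+ (b ℕ.+ count ↓)) cpk-↑peak cpk-peak↓ ⟨
    cpk π ℕ.+ count ↑ ℕ.+ (cpk π ℕ.+ count ↓)                          ∎
    where
    open ≡-Reasoning
    sum-ones : ∀ n → sumℕ {n} (λ _ → 1) ≡ n
    sum-ones zero    = refl
    sum-ones (suc n) = cong suc (sum-ones n)

  -- The edge into `x` is itself counted. Hence the predecessors taken in `subdivide` are never
  -- truncated.
  count-pos : ∀ x → suc (pred (count (edge x))) ≡ count (edge x)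
  count-pos x = go x (δ-refl (edge x))
    where
    go : ∀ {n} {f : Fin n → ℕ} x → f x ≡ 1 → suc (pred (sumℕ f)) ≡ sumℕ f
    go {suc n} {f} x fx≡1 = trans (cong (λ m → suc (pred m)) eq) (sym eq)
      where
      eq : sumℕ f ≡ suc (sumℕ (f ∘ punchIn x))
      eq = trans (sumℕ-remove f) (cong (ℕ._+ sumℕ (f ∘ punchIn x)) fx≡1)

-- The exponents (cpk π , exc π − cpk π , n − exc π − cpk π) of X, Y and Z, without truncated subtraction.
Counts : Set
Counts = ℕ × ℕ × ℕ

counts : ∀ {n} → Permutation′ n → Counts
counts π = cpk π , count π ↑ , count π ↓

-- `exc-count` and `size-count` determine the last two exponents by cancellation, so for an
-- insertion it is enough to follow `cpk`, `exc` and the size.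
counts-unique : ∀ {n} (σ : Permutation′ n) A B C → cpk σ ≡ A → exc σ ≡ A ℕ.+ B → n ≡ A ℕ.+ B ℕ.+ (A ℕ.+ C) → counts σ ≡ (A , B , C)
counts-unique σ A B C refl excσ size = cong (cpk σ ,_) (cong₂ _,_ ↑≡B ↓≡C)
  where
  ↑≡B : count σ ↑ ≡ B
  ↑≡B = ℕ.+-cancelˡ-≡ (cpk σ) _ _ (trans (sym (exc-count σ)) excσ)
  ↓≡C : count σ ↓ ≡ C
  ↓≡C = ℕ.+-cancelˡ-≡ (cpk σ) _ _ (ℕ.+-cancelˡ-≡ (cpk σ ℕ.+ B) _ _ (trans
    (cong (λ b → cpk σ ℕ.+ b ℕ.+ (cpk σ ℕ.+ count σ ↓)) (sym ↑≡B)) (trans (sym (size-count σ)) size)))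

counts-cong : ∀ {n} {σ τ : Permutation′ n} → σ Perm.≈ τ → counts σ ≡ counts τ
counts-cong {σ = σ} {τ} σ≈τ = counts-unique σ _ _ _ (cpk-cong {σ = σ} {τ} σ≈τ)
  (trans (exc-cong {σ = σ} {τ} σ≈τ) (exc-count τ)) (size-count τ)

-- The effect of replacing w → x by w → top → x. For `↑peak` the peak moves off `x`, whose outgoing
-- edge becomes an ordinary falling one; for `peak↓` it moves off `w`, whose incoming edge becomes
-- an ordinary rising one. An edge of kind `↑` or `↓` is used up to form the two edges of a new
-- peak.
subdivide : Edge → Counts → Counts
subdivide ↑peak (a , b , c) = a , b , suc c
subdivide ↑     (a , b , c) = suc a , pred b , c
subdivide peak↓ (a , b , c) = a , suc b , c
subdivide ↓     (a , b , c) = suc a , b , pred c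

private
  +1≡suc : ∀ {m k} → m ℕ.+ 1 ≡ suc k → m ≡ k
  +1≡suc {m} eq = ℕ.suc-injective (trans (ℕ.+-comm 1 m) eq)

  +0≡ : ∀ {m k} → m ℕ.+ 0 ≡ k → m ≡ k
  +0≡ {m} eq = trans (sym (ℕ.+-identityʳ m)) eq

counts-insertBefore : ∀ {n} (x : Fin n) (π : Permutation′ n) → counts (insertBefore (ι x) π) ≡ subdivide (edge π x) (counts π)
counts-insertBefore {n} x π = solve (edge π x) (cpk π) (count π ↑) (count π ↓)
  (trans (cong₂ (λ d d′ → cpk σ ℕ.+ (d ℕ.+ d′)) (sym (δ-↑peak π x)) (sym (δ-peak↓ π x))) (cpk-insertBefore π x))
  (trans (cong (exc σ ℕ.+_) (sym (δ-rise π x))) (trans (exc-insertBefore π x) (cong suc (exc-count π))))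
  (size-count π)
  (λ eq → subst (λ k → suc (pred (count π k)) ≡ count π k) eq (count-pos π x))
  (λ eq → subst (λ k → suc (pred (count π k)) ≡ count π k) eq (count-pos π x))
  where
  σ = insertBefore (ι x) π
  open ℕ.+-*-Solver using (_:+_; _:=_; con) renaming (solve to solveℕ)

  -- Abstracting the edge kind and the counts lets each case compute its `δ` values. The last two
  -- hypotheses rule out an edge of kind `↑` or `↓` whose own count is 0.
  solve : ∀ k a b c → cpk σ ℕ.+ (δ ↑peak k ℕ.+ δ peak↓ k) ≡ suc a → exc σ ℕ.+ (δ ↑peak k ℕ.+ δ ↑ k) ≡ suc (a ℕ.+ b) →
          n ≡ a ℕ.+ b ℕ.+ (a ℕ.+ c) → (k ≡ ↑ → suc (pred b) ≡ b) → (k ≡ ↓ → suc (pred c) ≡ c) →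
          counts σ ≡ subdivide k (a , b , c)
  solve ↑peak a b c p e s _ _ = counts-unique σ a b (suc c) (+1≡suc p) (+1≡suc e) (trans (cong suc s)
    (solveℕ 3 (λ a b c → con 1 :+ (a :+ b :+ (a :+ c)) := a :+ b :+ (a :+ (con 1 :+ c))) refl a b c))
  solve ↑ a zero c p e s b>0 _ = contradiction (b>0 refl) ℕ.1+n≢0
  solve ↑ a (suc b) c p e s _ _ = counts-unique σ (suc a) b c (+0≡ p) (trans (+1≡suc e) (ℕ.+-suc a b)) (trans (cong suc s)
    (solveℕ 3 (λ a b c → con 1 :+ (a :+ (con 1 :+ b) :+ (a :+ c)) := con 1 :+ a :+ b :+ (con 1 :+ a :+ c)) refl a b c))
  solve peak↓ a b c p e s _ _ = counts-unique σ a (suc b) c (+1≡suc p) (trans (+0≡ e) (sym (ℕ.+-suc a b))) (trans (cong suc s)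
    (solveℕ 3 (λ a b c → con 1 :+ (a :+ b :+ (a :+ c)) := a :+ (con 1 :+ b) :+ (a :+ c)) refl a b c))
  solve ↓ a b zero p e s _ c>0 = contradiction (c>0 refl) ℕ.1+n≢0
  solve ↓ a b (suc c) p e s _ _ = counts-unique σ (suc a) b c (+0≡ p) (+0≡ e) (trans (cong suc s)
    (solveℕ 3 (λ a b c → con 1 :+ (a :+ b :+ (a :+ (con 1 :+ c))) := con 1 :+ a :+ b :+ (con 1 :+ a :+ c)) refl a b c))

-- The loop at a new fixed point neither rises nor touches a peak, so only the exponent of Z grows.
counts-insertBefore-top : ∀ {n} (π : Permutation′ n) → counts (insertBefore top π) ≡ (cpk π , count π ↑ , suc (count π ↓))
counts-insertBefore-top π = counts-unique (insertBefore top π) _ _ _ (cpk-insertBefore-top π)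
  (trans (exc-insertBefore-top π) (exc-count π))
  (trans (cong suc (size-count π)) (solve 3 (λ a b c → con 1 :+ (a :+ b :+ (a :+ c)) := a :+ b :+ (a :+ (con 1 :+ c))) refl (cpk π) (count π ↑) (count π ↓)))
  where open ℕ.+-*-Solver using (solve; _:+_; _:=_; con)

-- Recurrence for the cyclic peak polynomial

module PeakPolynomial (R : CommutativeRing c ℓ) where

  open CommutativeRing R hiding (zero) renaming (refl to ≈-refl; sym to ≈-sym; trans to ≈-trans; setoid to ≈-setoid)
  open Polynomials R using (_^_; ∑)

  monomial : (x y z : Carrier) → Counts → Carrier
  monomial x y z (i , j , k) = x ^ i * y ^ j * z ^ k

  Q : ℕ → (x y z : Carrier) → Carrier
  Q n x y z = ∑ (𝔖-finite n) λ π → monomial x y z (counts π)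

module _ (R : CommutativeRing c ℓ) where

  open CommutativeRing R hiding (zero) renaming (refl to ≈-refl; sym to ≈-sym; trans to ≈-trans; setoid to ≈-setoid)
  open Polynomials R using (_^_; ∑)
  open Mult semiring using (×-cong; ×-assoc-*; ×-homo-+) renaming (_×_ to _·_)
  open Exp semiring using (^-congˡ)
  open FiniteSums R using (∑-enumeration; ∑-⊗; ∑-cong; ∑-swap; ∑-+; ∑-*ˡ; sum; sum-cong-≋; sum-remove)
  open DualNumbers R using (dual; ^-dual; proj₂-∑; module ε)
  open PeakPolynomial R
  private
    module Q̃ = PeakPolynomial dual
    module Solve = Solver commutativeSemiring
  open Solve using (solve; _:+_; _:*_; _:=_; con)
  open import Relation.Binary.Reasoning.Setoid ≈-setoid

  Q-cong : ∀ n {x x′ y y′ z z′} → x ≈ x′ → y ≈ y′ → z ≈ z′ → Q n x y z ≈ Q n x′ y′ z′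
  Q-cong n x≈ y≈ z≈ = ∑-cong (𝔖-finite n) λ π →
    *-cong (*-cong (^-congˡ (cpk π) x≈) (^-congˡ (count π ↑) y≈)) (^-congˡ (count π ↓) z≈)

  -- Turns a multiplicity into a ring element, which the solver can treat as an atom.
  ·-as-* : ∀ k u → k · u ≈ k · 1# * u
  ·-as-* k u = ≈-sym (≈-trans (×-assoc-* k 1# u) (×-cong {k} refl (*-identityˡ u)))

  sum-by-edge : ∀ {n} (f : Fin n → Edge) (g : Edge → Carrier) → let N = λ k → sumℕ (λ x → δ k (f x)) in
    sum (g ∘ f) ≈ N ↑peak · g ↑peak + N ↑ · g ↑ + (N peak↓ · g peak↓ + N ↓ · g ↓)
  sum-by-edge {zero}  f g = solve 0 (con 0 := con 0 :+ con 0 :+ (con 0 :+ con 0)) ≈-refl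
  sum-by-edge {suc n} f g = begin
    g (f zero) + sum (g ∘ f ∘ suc)
      ≈⟨ +-cong (one (f zero)) (sum-by-edge (f ∘ suc) g) ⟩
    (i ↑peak + i ↑ + (i peak↓ + i ↓)) + (r ↑peak + r ↑ + (r peak↓ + r ↓))
      ≈⟨ solve 8 (λ a b c d a′ b′ c′ d′ → (a :+ b :+ (c :+ d)) :+ (a′ :+ b′ :+ (c′ :+ d′))
                                       := (a :+ a′) :+ (b :+ b′) :+ ((c :+ c′) :+ (d :+ d′)))
               ≈-refl (i ↑peak) (i ↑) (i peak↓) (i ↓) (r ↑peak) (r ↑) (r peak↓) (r ↓) ⟩
    i ↑peak + r ↑peak + (i ↑ + r ↑) + (i peak↓ + r peak↓ + (i ↓ + r ↓))
      ≈⟨ +-cong (+-cong (join ↑peak) (join ↑)) (+-cong (join peak↓) (join ↓)) ⟨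
    N ↑peak · g ↑peak + N ↑ · g ↑ + (N peak↓ · g peak↓ + N ↓ · g ↓)  ∎
    where
    N N′ : Edge → ℕ
    N k = sumℕ (λ x → δ k (f x))
    N′ k = sumℕ (λ x → δ k (f (suc x)))
    i r : Edge → Carrier
    i k = δ k (f zero) · g k
    r k = N′ k · g k
    join : ∀ k → N k · g k ≈ i k + r k
    join k = ×-homo-+ (g k) (δ k (f zero)) (N′ k)
    one : ∀ e → g e ≈ δ ↑peak e · g ↑peak + δ ↑ e · g ↑ + (δ peak↓ e · g peak↓ + δ ↓ e · g ↓)
    one ↑peak = solve 1 (λ u → u := u :+ con 0 :+ con 0 :+ (con 0 :+ con 0)) ≈-refl (g ↑peak)
    one ↑     = solve 1 (λ u → u := con 0 :+ (u :+ con 0) :+ (con 0 :+ con 0)) ≈-refl (g ↑)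
    one peak↓ = solve 1 (λ u → u := con 0 :+ con 0 :+ ((u :+ con 0) :+ con 0)) ≈-refl (g peak↓)
    one ↓     = solve 1 (λ u → u := con 0 :+ con 0 :+ (con 0 :+ (u :+ con 0))) ≈-refl (g ↓)

  module _ (x y z : Carrier) where

    private
      x̃ ỹ z̃ : Carrier × Carrier
      x̃ = x , x * (y + z)
      ỹ = y , x
      z̃ = z , x

    -- The product rule read as a sum over edges: the coefficients are the numbers of edges of each
    -- kind. The power of `x` contributes twice, with coefficient `a` each time, because X(Y + Z)
    -- has one term for each of the two edges at a peak.
    monomial-derivative : ∀ a b c → let M = λ k → monomial x y z (subdivide k (a , b , c)) in
      proj₂ (Q̃.monomial x̃ ỹ z̃ (a , b , c)) ≈ a · M ↑peak + b · M ↑ + (a · M peak↓ + c · M ↓)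
    monomial-derivative a b c = begin
      proj₂ (Q̃.monomial x̃ ỹ z̃ (a , b , c))
        ≈⟨ proj₂ (ε.*-cong (ε.*-cong (^-dual x (x * (y + z)) a) (^-dual y x b)) (^-dual z x c)) ⟩
      x ^ a * y ^ b * (c · (z ^ pred c * x)) + (x ^ a * (b · (y ^ pred b * x)) + a · (x ^ pred a * (x * (y + z))) * y ^ b) * z ^ c
        ≈⟨ +-cong (*-congˡ (·-as-* c _)) (*-congʳ (+-cong (*-congˡ (·-as-* b _)) (*-congʳ (≈-trans (absorb a) (·-as-* a _))))) ⟩
      x ^ a * y ^ b * (c · 1# * (z ^ pred c * x)) + (x ^ a * (b · 1# * (y ^ pred b * x)) + a · 1# * (x ^ a * (y + z)) * y ^ b) * z ^ c
        ≈⟨ solve 11 (λ x y z xa yb zc yb′ zc′ a b c →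
             xa :* yb :* (c :* (zc′ :* x)) :+ (xa :* (b :* (yb′ :* x)) :+ a :* (xa :* (y :+ z)) :* yb) :* zc
             := a :* (xa :* yb :* (z :* zc)) :+ b :* (x :* xa :* yb′ :* zc) :+ (a :* (xa :* (y :* yb) :* zc) :+ c :* (x :* xa :* yb :* zc′)))
             ≈-refl x y z (x ^ a) (y ^ b) (z ^ c) (y ^ pred b) (z ^ pred c) (a · 1#) (b · 1#) (c · 1#) ⟩
      a · 1# * M ↑peak + b · 1# * M ↑ + (a · 1# * M peak↓ + c · 1# * M ↓)
        ≈⟨ +-cong (+-cong (·-as-* a _) (·-as-* b _)) (+-cong (·-as-* a _) (·-as-* c _)) ⟨
      a · M ↑peak + b · M ↑ + (a · M peak↓ + c · M ↓)  ∎
      where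
      M : Edge → Carrier
      M k = monomial x y z (subdivide k (a , b , c))
      -- Merging x with `x ^ pred a` into `x ^ a` is legitimate only for positive `a`; for `a` = 0
      -- both multiples vanish.
      absorb : ∀ a → a · (x ^ pred a * (x * (y + z))) ≈ a · (x ^ a * (y + z))
      absorb zero    = ≈-refl
      absorb (suc a) = ×-cong {suc a} refl (solve 3 (λ xa x w → xa :* (x :* w) := x :* xa :* w) ≈-refl (x ^ a) x (y + z))

    sum-insertBefore : ∀ {n} (π : Permutation′ n) →
      sum (λ i → monomial x y z (counts (insertBefore i π))) ≈ z * monomial x y z (counts π) + proj₂ (Q̃.monomial x̃ ỹ z̃ (counts π))
    sum-insertBefore π = begin
      sum (λ i → monomial x y z (counts (insertBefore i π)))
        ≈⟨ sum-remove {i = top} (λ i → monomial x y z (counts (insertBefore i π))) ⟩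
      monomial x y z (counts (insertBefore top π)) + sum (λ i → monomial x y z (counts (insertBefore (ι i) π)))
        ≈⟨ +-cong (reflexive (cong (monomial x y z) (counts-insertBefore-top π)))
                  (sum-cong-≋ (λ i → reflexive (cong (monomial x y z) (counts-insertBefore i π)))) ⟩
      monomial x y z (cpk π , count π ↑ , suc (count π ↓)) + sum (M ∘ edge π)
        ≈⟨ +-cong (solve 4 (λ a b c z → a :* b :* (z :* c) := z :* (a :* b :* c)) ≈-refl (x ^ cpk π) (y ^ count π ↑) (z ^ count π ↓) z)
                  (sum-by-edge (edge π) M) ⟩
      z * monomial x y z (counts π) + (count π ↑peak · M ↑peak + count π ↑ · M ↑ + (count π peak↓ · M peak↓ + count π ↓ · M ↓))
        ≈⟨ +-congˡ (+-cong (+-congʳ (×-cong (cpk-↑peak π) ≈-refl)) (+-congʳ (×-cong (cpk-peak↓ π) ≈-refl))) ⟨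
      z * monomial x y z (counts π) + (cpk π · M ↑peak + count π ↑ · M ↑ + (cpk π · M peak↓ + count π ↓ · M ↓))
        ≈⟨ +-congˡ (monomial-derivative (cpk π) (count π ↑) (count π ↓)) ⟨
      z * monomial x y z (counts π) + proj₂ (Q̃.monomial x̃ ỹ z̃ (counts π))  ∎
      where
      M : Edge → Carrier
      M k = monomial x y z (subdivide k (counts π))

    Q-suc : ∀ n → Q (suc n) x y z ≈ z * Q n x y z + proj₂ (Q̃.Q n x̃ ỹ z̃)
    Q-suc n = begin
      ∑ (𝔖-finite (suc n)) W
        ≈⟨ ∑-enumeration (𝔖-finite (suc n)) (transport (insertBefore-inverse n) (F ⊗ 𝔖-finite n)) {W}
             (λ {σ} {τ} σ≈τ → reflexive (cong (monomial x y z) (counts-cong {σ = σ} {τ} σ≈τ))) ⟩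
      ∑ (F ⊗ 𝔖-finite n) (λ (i , π) → W (insertBefore i π))
        ≈⟨ ∑-⊗ F (𝔖-finite n) (λ (i , π) → W (insertBefore i π)) ⟩
      ∑ F (λ i → ∑ (𝔖-finite n) λ π → W (insertBefore i π))
        ≈⟨ ∑-swap F (𝔖-finite n) (λ i π → W (insertBefore i π)) ⟩
      ∑ (𝔖-finite n) (λ π → sum (λ i → W (insertBefore i π)))
        ≈⟨ ∑-cong (𝔖-finite n) sum-insertBefore ⟩
      ∑ (𝔖-finite n) (λ π → z * W π + proj₂ (Q̃.monomial x̃ ỹ z̃ (counts π)))
        ≈⟨ ∑-+ (𝔖-finite n) (λ π → z * W π) (λ π → proj₂ (Q̃.monomial x̃ ỹ z̃ (counts π))) ⟩
      ∑ (𝔖-finite n) (λ π → z * W π) + ∑ (𝔖-finite n) (λ π → proj₂ (Q̃.monomial x̃ ỹ z̃ (counts π)))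
        ≈⟨ +-cong (∑-*ˡ (𝔖-finite n) z W) (reflexive (sym (proj₂-∑ (𝔖-finite n) (λ π → Q̃.monomial x̃ ỹ z̃ (counts π))))) ⟩
      z * Q n x y z + proj₂ (Q̃.Q n x̃ ỹ z̃)  ∎
      where
      F : Finite (setoid (Fin (suc n)))
      F = suc n , Id.inverse _
      W : ∀ {n} → Permutation′ n → Carrier
      W π = monomial x y z (counts π)

-- Inserting a letter ±(n+1) into the word of a signed permutation

insertTop-inverse : ∀ n → Inverse (setoid (Fin (suc n)) ×ₛ 𝔖 n) (𝔖 (suc n))
insertTop-inverse n = injective∧section⇒inverse (setoid (Fin (suc n)) ×ₛ 𝔖 n) (𝔖 (suc n))
  (λ (i , π) → insert i top π)
  (λ σ → σ ⟨$⟩ˡ top , remove (σ ⟨$⟩ˡ top) σ)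
  (λ { (i , π) (_ , ρ) (refl , π≈ρ) → insert-cong i top {π} {ρ} π≈ρ })
  (λ (i , π) (j , ρ) → injective i j π ρ)
  section
  where
  injective : ∀ i j (π ρ : Permutation′ n) → insert i top π Perm.≈ insert j top ρ → i ≡ j × π Perm.≈ ρ
  injective i j π ρ eq
    with refl ← permutation-injective (insert j top ρ) (trans (sym (eq i)) (trans (insert-at i top π) (sym (insert-at j top ρ))))
    = refl , insert-injective i top π ρ eq

  section : ∀ σ → insert (σ ⟨$⟩ˡ top) top (remove (σ ⟨$⟩ˡ top) σ) Perm.≈ σ
  section σ k = trans
    (cong (λ j → insert i j (remove i σ) ⟨$⟩ʳ k) (sym (Perm.inverseʳ σ)))
    (insert-remove i σ k)
    where i = σ ⟨$⟩ˡ top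

≗-by-position : ∀ {a} {A : Set a} {n} (f g : Fin (suc n) → A) i → f i ≡ g i → f ∘ punchIn i ≗ g ∘ punchIn i → f ≗ g
≗-by-position f g i fi≡gi f≗g k with i Fin.≟ k
... | yes refl = fi≡gi
... | no i≢k   = subst (λ k → f k ≡ g k) (Fin.punchIn-punchOut i≢k) (f≗g (punchOut i≢k))

insertAt-inverse : ∀ {a} (A : Set a) n → Fin (suc n) → Inverse (setoid A ×ₛ (Fin n →-setoid A)) (Fin (suc n) →-setoid A)
insertAt-inverse A n i = injective∧section⇒inverse (setoid A ×ₛ (Fin n →-setoid A)) (Fin (suc n) →-setoid A)
  (λ (a , f) → insertAt f i a)
  (λ f → f i , removeAt f i)
  (λ { (a , f) (_ , g) (refl , f≗g) → ≗-by-position (insertAt f i a) (insertAt g i a) i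
         (trans (insertAt-lookup f i a) (sym (insertAt-lookup g i a)))
         (λ j → trans (insertAt-punchIn f i a j) (trans (f≗g j) (sym (insertAt-punchIn g i a j)))) })
  (λ (a , f) (b , g) eq →
      trans (sym (insertAt-lookup f i a)) (trans (eq i) (insertAt-lookup g i b))
    , λ j → trans (sym (insertAt-punchIn f i a j)) (trans (eq (punchIn i j)) (insertAt-punchIn g i b j)))
  (λ f → insertAt-removeAt f i)

letters : ∀ {n} → (Fin n → Sign) → Permutation′ n → Fin n → ℤ
letters ε π i = value (ε i , π ⟨$⟩ʳ i)

value-ι : ∀ {n} s (i : Fin n) → value (s , ι i) ≡ value (s , i)
value-ι s i = cong (λ k → s ℤ.◃ suc k) (toℕ-ι i)

letters-insert : ∀ {n} (ε : Fin n → Sign) (π : Permutation′ n) i s →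
                 letters (insertAt ε i s) (insert i top π) ≗ insertAt (letters ε π) i (value (s , top {n}))
letters-insert {n} ε π i s = ≗-by-position _ _ i
  (trans (cong₂ (λ s j → value (s , j)) (insertAt-lookup ε i s) (insert-at i top π))
         (sym (insertAt-lookup (letters ε π) i (value (s , top)))))
  (λ j → trans (cong₂ (λ s j → value (s , j)) (insertAt-punchIn ε i s j) (insert-punchIn i top π j))
        (trans (value-ι (ε j) (π ⟨$⟩ʳ j)) (sym (insertAt-punchIn (letters ε π) i (value (s , top {n})) j))))

value<top : ∀ {n} (x : ±[ n ]) → value x ℤ.< value (Sign.+ , top {n})
value<top {n} (Sign.+ , i) = +<+ (s≤s (subst (toℕ i ℕ.<_) (sym (Fin.toℕ-fromℕ n)) (Fin.toℕ<n i)))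
value<top     (Sign.- , i) = -<+

-top<value : ∀ {n} (x : ±[ n ]) → value (Sign.- , top {n}) ℤ.< value x
-top<value     (Sign.+ , i) = -<+
-top<value {n} (Sign.- , i) = -<- (subst (toℕ i ℕ.<_) (sym (Fin.toℕ-fromℕ n)) (Fin.toℕ<n i))

-- Weights of signed words

module SignedPolynomial (R : CommutativeRing c ℓ) where

  open CommutativeRing R hiding (zero) renaming (refl to ≈-refl; sym to ≈-sym; trans to ≈-trans; setoid to ≈-setoid)
  open Polynomials R using (∑)

  step : (s t : Carrier) → ℤ → ℤ → Carrier
  step s t a b = if does (b ℤ.<? a) then t else s

  -- The integer argument is the letter in front of the word; `weight` starts it at `0ℤ`, the
  -- convention σ(0) = 0.
  desWeight : ∀ {n} (s t : Carrier) → ℤ → (Fin n → ℤ) → Carrier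
  desWeight {zero}  s t a w = 1#
  desWeight {suc n} s t a w = step s t a (w zero) * desWeight s t (w zero) (tail w)

  negWeight : ∀ {n} (y : Carrier) → (Fin n → ℤ) → Carrier
  negWeight {zero}  y w = 1#
  negWeight {suc n} y w = (if does (w zero ℤ.<? 0ℤ) then y else 1#) * negWeight y (tail w)

  weight : ∀ {n} (s t y : Carrier) → (Fin n → ℤ) → Carrier
  weight s t y w = negWeight y w * desWeight s t 0ℤ w

  -- This is B_n homogenized by `s`, with the sum over signed permutations split into absolute
  -- values and signs.
  L : ℕ → (s t y : Carrier) → Carrier
  L n s t y = ∑ (𝔖-finite n) λ π → ∑ (signs-finite n) λ ε → weight s t y (letters ε π)

  desWeight-cong : ∀ {n} s t a {v w : Fin n → ℤ} → v ≗ w → desWeight s t a v ≡ desWeight s t a w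
  desWeight-cong {zero}  s t a         v≗w = refl
  desWeight-cong {suc n} s t a {v} {w} v≗w = cong₂ _*_ (cong (step s t a) (v≗w zero))
    (trans (cong (λ b → desWeight s t b (tail v)) (v≗w zero)) (desWeight-cong s t (w zero) (v≗w ∘ suc)))

  negWeight-cong : ∀ {n} y {v w : Fin n → ℤ} → v ≗ w → negWeight y v ≡ negWeight y w
  negWeight-cong {zero}  y v≗w = refl
  negWeight-cong {suc n} y v≗w = cong₂ _*_ (cong (λ a → if does (a ℤ.<? 0ℤ) then y else 1#) (v≗w zero)) (negWeight-cong y (v≗w ∘ suc))

  weight-cong : ∀ {n} s t y (v w : Fin n → ℤ) → v ≗ w → weight s t y v ≡ weight s t y w
  weight-cong s t y v w v≗w = cong₂ _*_ (negWeight-cong y v≗w) (desWeight-cong s t 0ℤ v≗w)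

  step-desc : ∀ {s t a b} → b ℤ.< a → step s t a b ≡ t
  step-desc {s} {t} {a} {b} b<a = cong (if_then t else s) (dec-true (b ℤ.<? a) b<a)

  step-asc : ∀ {s t a b} → a ℤ.< b → step s t a b ≡ s
  step-asc {s} {t} {a} {b} a<b = cong (if_then t else s) (dec-false (b ℤ.<? a) (ℤ.<-asym a<b))

-- Recurrence for the homogenized descent polynomial

module _ (R : CommutativeRing c ℓ) where

  open CommutativeRing R hiding (zero) renaming (refl to ≈-refl; sym to ≈-sym; trans to ≈-trans; setoid to ≈-setoid)
  open Polynomials R using (∑)
  open FiniteSums R using (sum; sum-cong-≋; ∑-distrib-+; ∑-enumeration; ∑-⊗; ∑-cong; ∑-swap; ∑-+; ∑-*ˡ)
  open DualNumbers R using (dual; proj₂-∑; module ε)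
  open SignedPolynomial R
  open SemiringSum semiring using (*-distribˡ-sum)
  private
    module L̃ = SignedPolynomial dual
    module Solve = Solver commutativeSemiring
  open Solve using (solve; _:+_; _:*_; _:=_; con)
  open import Relation.Binary.Reasoning.Setoid ≈-setoid

  module _ (s t : Carrier) where

    -- The derivative of desWeight for the derivation with s′ = t′ = 1.
    ∂desWeight : ∀ {n} → ℤ → (Fin n → ℤ) → Carrier
    ∂desWeight {zero}  a w = 0#
    ∂desWeight {suc n} a w = desWeight s t (w zero) (tail w) + step s t a (w zero) * ∂desWeight (w zero) (tail w)

    -- Ascents and descents have the same derivative `τ`, so every step contributes `τ` whatever its
    -- direction and `τ` factors out.
    desWeight-dual : ∀ τ {n} a (w : Fin n → ℤ) →
                     L̃.desWeight (s , τ) (t , τ) a w ε.≈ (desWeight s t a w , τ * ∂desWeight a w)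
    desWeight-dual τ {zero}  a w = ≈-refl , ≈-sym (zeroʳ τ)
    desWeight-dual τ {suc n} a w = ε.trans
      (ε.*-cong (step-dual (w zero)) (desWeight-dual τ (w zero) (tail w)))
      (≈-refl , solve 4 (λ k τ d w → k :* (τ :* d) :+ τ :* w := τ :* (w :+ k :* d)) ≈-refl
                  (step s t a (w zero)) τ (∂desWeight (w zero) (tail w)) (desWeight s t (w zero) (tail w)))
      where
      step-dual : ∀ b → L̃.step (s , τ) (t , τ) a b ε.≈ (step s t a b , τ)
      step-dual b with does (b ℤ.<? a)
      ... | true  = ε.refl
      ... | false = ε.refl

    -- The letter `m` is extreme: every step into it weighs `h` and every step out of it weighs `g`.
    -- At the end of the word it merely adds a factor `h`; in a gap it replaces the step there by
    -- `h * g`, and removing each step in turn is what `∂desWeight` sums.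
    sum-desWeight-insert : ∀ {n} {m} {g h} a (w : Fin n → ℤ) →
      step s t a m ≡ h → (∀ i → step s t (w i) m ≡ h) → (∀ i → step s t m (w i) ≡ g) →
      sum (λ i → desWeight s t a (insertAt w i m)) ≈ h * desWeight s t a w + h * g * ∂desWeight a w
    sum-desWeight-insert {zero} {m} {g} {h} a w am wm mw = begin
      step s t a m * 1# + 0#   ≈⟨ +-congʳ (*-congʳ (reflexive am)) ⟩
      h * 1# + 0#              ≈⟨ +-congˡ (zeroʳ (h * g)) ⟨
      h * 1# + h * g * 0#      ∎
    sum-desWeight-insert {suc n} {m} {g} {h} a w am wm mw = begin
      step s t a m * (step s t m b * W) + sum (λ i → k * desWeight s t b (insertAt (tail w) i m))
        ≈⟨ +-cong (*-cong (reflexive am) (*-congʳ (reflexive (mw zero)))) (≈-sym (*-distribˡ-sum k (λ i → desWeight s t b (insertAt (tail w) i m)))) ⟩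
      h * (g * W) + k * sum (λ i → desWeight s t b (insertAt (tail w) i m))
        ≈⟨ +-congˡ (*-congˡ (sum-desWeight-insert b (tail w) (wm zero) (wm ∘ suc) (mw ∘ suc))) ⟩
      h * (g * W) + k * (h * W + h * g * D)
        ≈⟨ solve 5 (λ h g k W D → h :* (g :* W) :+ k :* (h :* W :+ h :* g :* D)
                               := h :* (k :* W) :+ h :* g :* (W :+ k :* D)) ≈-refl h g k W D ⟩
      h * (k * W) + h * g * (W + k * D)  ∎
      where
      b = w zero
      k = step s t a b
      W = desWeight s t b (tail w)
      D = ∂desWeight b (tail w)

  module _ (y : Carrier) where

    negWeight-dual : ∀ {n} (w : Fin n → ℤ) → L̃.negWeight (y , 0#) w ε.≈ (negWeight y w , 0#)
    negWeight-dual {zero}  w = ε.refl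
    negWeight-dual {suc n} w = ε.trans (ε.*-cong letter-dual (negWeight-dual (tail w)))
      (≈-refl , solve 2 (λ u v → u :* con 0 :+ con 0 :* v := con 0) ≈-refl _ _)
      where
      letter-dual : (if does (w zero ℤ.<? 0ℤ) then (y , 0#) else (1# , 0#)) ε.≈ ((if does (w zero ℤ.<? 0ℤ) then y else 1#) , 0#)
      letter-dual with does (w zero ℤ.<? 0ℤ)
      ... | true  = ε.refl
      ... | false = ε.refl

    negWeight-insert : ∀ {n} (w : Fin n → ℤ) i m →
      negWeight y (insertAt w i m) ≈ (if does (m ℤ.<? 0ℤ) then y else 1#) * negWeight y w
    negWeight-insert         w zero    m = ≈-refl
    negWeight-insert {suc n} w (suc i) m = ≈-trans (*-congˡ (negWeight-insert (tail w) i m))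
      (solve 3 (λ u v w → u :* (v :* w) := v :* (u :* w)) ≈-refl _ _ _)

  module _ (s t y : Carrier) where

    private
      τ : Carrier
      τ = (1# + y) * (s * t)

      s̃ t̃ ỹ : Carrier × Carrier
      s̃ = s , τ
      t̃ = t , τ
      ỹ = y , 0#

      signFinite : Finite (setoid Sign)
      signFinite = 2 , 2↔Sign

    -- For n+1 the pair (h, g) is (s, t), for -(n+1) it is (t, s) with an extra factor `y`. The end
    -- position thus contributes s + yt, and the gaps contribute st + yts, which is the constant
    -- `τ`.
    sum-weight-insert : ∀ {n} (ε : Fin n → Sign) (π : Permutation′ n) → let w = letters ε π in
      sum (λ i → ∑ signFinite λ σ → weight s t y (insertAt w i (value (σ , top {n})))) ≈ (s + y * t) * weight s t y w + proj₂ (L̃.weight s̃ t̃ ỹ w)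
    sum-weight-insert {n} ε π = begin
      sum (λ i → weight s t y (insertAt w i m₊) + (weight s t y (insertAt w i m₋) + 0#))
        ≈⟨ sum-cong-≋ (λ i → +-cong (*-congʳ {D₊ i} (negWeight-insert y w i m₊)) (≈-trans (+-identityʳ _) (*-congʳ {D₋ i} (negWeight-insert y w i m₋)))) ⟩
      sum (λ i → 1# * N * D₊ i + y * N * D₋ i)
        ≈⟨ ∑-distrib-+ (λ i → 1# * N * D₊ i) (λ i → y * N * D₋ i) ⟩
      sum (λ i → 1# * N * D₊ i) + sum (λ i → y * N * D₋ i)
        ≈⟨ +-cong (*-distribˡ-sum (1# * N) D₊) (*-distribˡ-sum (y * N) D₋) ⟨
      1# * N * sum D₊ + y * N * sum D₋
        ≈⟨ +-cong (*-congˡ (sum-desWeight-insert s t 0ℤ w (step-asc {s} {t} -<0+) (λ i → step-asc (value<top (x i))) (λ i → step-desc (value<top (x i)))))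
                  (*-congˡ (sum-desWeight-insert s t 0ℤ w (step-desc {s} {t} -<0-) (λ i → step-desc (-top<value (x i))) (λ i → step-asc (-top<value (x i))))) ⟩
      1# * N * (s * W + s * t * ∂W) + y * N * (t * W + t * s * ∂W)
        ≈⟨ solve 6 (λ N W D s t y → con 1 :* N :* (s :* W :+ s :* t :* D) :+ y :* N :* (t :* W :+ t :* s :* D)
                                 := (s :+ y :* t) :* (N :* W) :+ (N :* ((con 1 :+ y) :* (s :* t) :* D) :+ con 0 :* W)) ≈-refl N W ∂W s t y ⟩
      (s + y * t) * (N * W) + (N * (τ * ∂W) + 0# * W)
        ≈⟨ +-congˡ (proj₂ (ε.*-cong (negWeight-dual y w) (desWeight-dual s t τ 0ℤ w))) ⟨
      (s + y * t) * weight s t y w + proj₂ (L̃.weight s̃ t̃ ỹ w)  ∎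
      where
      x : Fin n → ±[ n ]
      x i = ε i , π ⟨$⟩ʳ i
      w : Fin n → ℤ
      w = letters ε π
      m₊ m₋ : ℤ
      m₊ = value (Sign.+ , top {n})
      m₋ = value (Sign.- , top {n})
      -<0+ : 0ℤ ℤ.< m₊
      -<0+ = +<+ (s≤s z≤n)
      -<0- : m₋ ℤ.< 0ℤ
      -<0- = -<+
      N W ∂W : Carrier
      N = negWeight y w
      W = desWeight s t 0ℤ w
      ∂W = ∂desWeight s t 0ℤ w
      D₊ D₋ : Fin (suc n) → Carrier
      D₊ i = desWeight s t 0ℤ (insertAt w i m₊)
      D₋ i = desWeight s t 0ℤ (insertAt w i m₋)

    L-suc : ∀ n → L (suc n) s t y ≈ (s + y * t) * L n s t y + proj₂ (L̃.L n s̃ t̃ ỹ)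
    L-suc n = begin
      ∑ 𝔖′ (λ π → ∑ Σ′ λ ε → ω ε π)
        ≈⟨ ∑-enumeration 𝔖′ (transport (insertTop-inverse n) (F ⊗ 𝔖ₙ)) {λ π → ∑ Σ′ λ ε → ω ε π}
             (λ {π} {ρ} π≈ρ → ∑-cong Σ′ λ ε → reflexive (weight-cong s t y (letters ε π) (letters ε ρ) λ i → cong (λ j → value (ε i , j)) (π≈ρ i))) ⟩
      ∑ (F ⊗ 𝔖ₙ) (λ (i , π) → ∑ Σ′ λ ε → ω ε (insert i top π))
        ≈⟨ ∑-⊗ F 𝔖ₙ (λ (i , π) → ∑ Σ′ λ ε → ω ε (insert i top π)) ⟩
      ∑ F (λ i → ∑ 𝔖ₙ λ π → ∑ Σ′ λ ε → ω ε (insert i top π))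
        ≈⟨ ∑-swap F 𝔖ₙ (λ i π → ∑ Σ′ λ ε → ω ε (insert i top π)) ⟩
      ∑ 𝔖ₙ (λ π → ∑ F λ i → ∑ Σ′ λ ε → ω ε (insert i top π))
        ≈⟨ ∑-cong 𝔖ₙ (λ π → per-permutation π) ⟩
      ∑ 𝔖ₙ (λ π → ∑ Σₙ λ ε → (s + y * t) * ω ε π + ω̃ ε π)
        ≈⟨ ∑-cong 𝔖ₙ (λ π → ≈-trans (∑-+ Σₙ (λ ε → (s + y * t) * ω ε π) (λ ε → ω̃ ε π)) (+-congʳ (∑-*ˡ Σₙ (s + y * t) (λ ε → ω ε π)))) ⟩
      ∑ 𝔖ₙ (λ π → (s + y * t) * ∑ Σₙ (λ ε → ω ε π) + ∑ Σₙ λ ε → ω̃ ε π)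
        ≈⟨ ∑-+ 𝔖ₙ (λ π → (s + y * t) * ∑ Σₙ (λ ε → ω ε π)) (λ π → ∑ Σₙ λ ε → ω̃ ε π) ⟩
      ∑ 𝔖ₙ (λ π → (s + y * t) * ∑ Σₙ (λ ε → ω ε π)) + ∑ 𝔖ₙ (λ π → ∑ Σₙ λ ε → ω̃ ε π)
        ≈⟨ +-cong (∑-*ˡ 𝔖ₙ (s + y * t) (λ π → ∑ Σₙ (λ ε → ω ε π))) (≈-sym dual-part) ⟩
      (s + y * t) * L n s t y + proj₂ (L̃.L n s̃ t̃ ỹ)  ∎
      where
      𝔖ₙ = 𝔖-finite n
      𝔖′ = 𝔖-finite (suc n)
      Σₙ = signs-finite n
      Σ′ = signs-finite (suc n)
      F : Finite (setoid (Fin (suc n)))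
      F = suc n , Id.inverse _
      ω : ∀ {n} → (Fin n → Sign) → Permutation′ n → Carrier
      ω ε π = weight s t y (letters ε π)
      ω̃ : (Fin n → Sign) → Permutation′ n → Carrier
      ω̃ ε π = proj₂ (L̃.weight s̃ t̃ ỹ (letters ε π))

      dual-part : proj₂ (L̃.L n s̃ t̃ ỹ) ≈ ∑ 𝔖ₙ (λ π → ∑ Σₙ λ ε → ω̃ ε π)
      dual-part = ≈-trans (reflexive (proj₂-∑ 𝔖ₙ (λ π → ε.∑ Σₙ λ ε → L̃.weight s̃ t̃ ỹ (letters ε π))))
        (∑-cong 𝔖ₙ λ π → reflexive (proj₂-∑ Σₙ (λ ε → L̃.weight s̃ t̃ ỹ (letters ε π))))

      per-permutation : ∀ π → ∑ F (λ i → ∑ Σ′ λ ε → ω ε (insert i top π)) ≈ ∑ Σₙ λ ε → (s + y * t) * ω ε π + ω̃ ε π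
      per-permutation π = begin
        ∑ F (λ i → ∑ Σ′ λ ε → ω ε (insert i top π))
          -- The enumeration of the sign vectors depends on the position `i`, so that the new sign
          -- is the one attached to the new letter.
          ≈⟨ ∑-cong F (λ i → ∑-enumeration Σ′ (transport (insertAt-inverse Sign n i) (signFinite ⊗ Σₙ)) {λ ε → ω ε (insert i top π)}
               (λ {ε} {η} ε≗ → reflexive (weight-cong s t y (letters ε (insert i top π)) (letters η (insert i top π)) λ j → cong (λ s → value (s , insert i top π ⟨$⟩ʳ j)) (ε≗ j)))) ⟩
        ∑ F (λ i → ∑ (signFinite ⊗ Σₙ) λ (σ , ε) → ω (insertAt ε i σ) (insert i top π))
          ≈⟨ ∑-cong F (λ i → ≈-trans (∑-⊗ signFinite Σₙ (λ (σ , ε) → ω (insertAt ε i σ) (insert i top π)))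
               (∑-swap signFinite Σₙ (λ σ ε → ω (insertAt ε i σ) (insert i top π)))) ⟩
        ∑ F (λ i → ∑ Σₙ λ ε → ∑ signFinite λ σ → ω (insertAt ε i σ) (insert i top π))
          ≈⟨ ∑-swap F Σₙ (λ i ε → ∑ signFinite λ σ → ω (insertAt ε i σ) (insert i top π)) ⟩
        ∑ Σₙ (λ ε → ∑ F λ i → ∑ signFinite λ σ → ω (insertAt ε i σ) (insert i top π))
          ≈⟨ ∑-cong Σₙ (λ ε → ∑-cong F λ i → ∑-cong signFinite λ σ → reflexive (weight-cong s t y (letters (insertAt ε i σ) (insert i top π)) (insertAt (letters ε π) i (value (σ , top {n}))) (letters-insert ε π i σ))) ⟩
        ∑ Σₙ (λ ε → ∑ F λ i → ∑ signFinite λ σ → weight s t y (insertAt (letters ε π) i (value (σ , top {n}))))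
          ≈⟨ ∑-cong Σₙ (λ ε → sum-weight-insert ε π) ⟩
        ∑ Σₙ (λ ε → (s + y * t) * ω ε π + ω̃ ε π)  ∎

#-suc : ∀ {n p} {P : Pred (Fin (suc n)) p} (P? : Decidable P) → # P? ≡ ind (P? zero) ℕ.+ # (λ i → P? (suc i))
#-suc P? = trans (#-sum P?) (cong (ind (P? zero) ℕ.+_) (sym (#-sum (λ i → P? (suc i)))))

-- Equality of the two homogeneous polynomials

L≈Q : ∀ n (R : CommutativeRing c ℓ) → let open CommutativeRing R in ∀ s t y →
      SignedPolynomial.L R n s t y ≈ PeakPolynomial.Q R n ((1# + y) * (1# + y) * (s * t)) (y * s + t) (s + y * t)
L≈Q zero R s t y = solve 0 (con 1 :* con 1 :+ con 0 :+ con 0 := con 1 :* con 1 :* con 1 :+ con 0) (CommutativeRing.refl R)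
  where open Solver (CommutativeRing.commutativeSemiring R) using (solve; _:+_; _:*_; _:=_; con)
L≈Q (suc n) R s t y = begin
  L (suc n) s t y
    ≈⟨ L-suc R s t y n ⟩
  (s + y * t) * L n s t y + proj₂ (L̃.L n s̃ t̃ ỹ)
    -- The induction hypothesis is used twice, over `R` and over its dual numbers. `X̃`, `Ỹ` and
    -- `Z̃` compute the derivatives of the three arguments, which are exactly the perturbations in
    -- `Q-suc`.
    ≈⟨ +-cong (*-congˡ (L≈Q n R s t y)) (proj₂ (ε.trans (L≈Q n dual s̃ t̃ ỹ) (Q-cong dual n X̃ Ỹ Z̃))) ⟩
  Z * Q n X Y Z + proj₂ (Q̃.Q n (X , X * (Y + Z)) (Y , X) (Z , X))
    ≈⟨ Q-suc R X Y Z n ⟨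
  Q (suc n) X Y Z  ∎
  where
  open CommutativeRing R hiding (zero) renaming (refl to ≈-refl)
  open DualNumbers R using (dual; module ε)
  open SignedPolynomial R using (L)
  open PeakPolynomial R using (Q)
  module L̃ = SignedPolynomial dual
  module Q̃ = PeakPolynomial dual
  open Solver commutativeSemiring using (solve; _:+_; _:*_; _:=_; con)
  open import Relation.Binary.Reasoning.Setoid (CommutativeRing.setoid R)
  X Y Z τ : Carrier
  X = (1# + y) * (1# + y) * (s * t)
  Y = y * s + t
  Z = s + y * t
  τ = (1# + y) * (s * t)
  s̃ t̃ ỹ : Carrier × Carrier
  s̃ = s , τ
  t̃ = t , τ
  ỹ = y , 0#
  X̃ : (ε.1# ε.+ ỹ) ε.* (ε.1# ε.+ ỹ) ε.* (s̃ ε.* t̃) ε.≈ (X , X * (Y + Z))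
  X̃ = ≈-refl , solve 3 (λ s t y →
    (con 1 :+ y) :* (con 1 :+ y) :* (s :* ((con 1 :+ y) :* (s :* t)) :+ (con 1 :+ y) :* (s :* t) :* t)
      :+ ((con 1 :+ y) :* (con 0 :+ con 0) :+ (con 0 :+ con 0) :* (con 1 :+ y)) :* (s :* t)
    := (con 1 :+ y) :* (con 1 :+ y) :* (s :* t) :* ((y :* s :+ t) :+ (s :+ y :* t))) ≈-refl s t y
  Ỹ : ỹ ε.* s̃ ε.+ t̃ ε.≈ (Y , X)
  Ỹ = ≈-refl , solve 3 (λ s t y →
    (y :* ((con 1 :+ y) :* (s :* t)) :+ con 0 :* s) :+ (con 1 :+ y) :* (s :* t)
    := (con 1 :+ y) :* (con 1 :+ y) :* (s :* t)) ≈-refl s t y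
  Z̃ : s̃ ε.+ ỹ ε.* t̃ ε.≈ (Z , X)
  Z̃ = ≈-refl , solve 3 (λ s t y →
    (con 1 :+ y) :* (s :* t) :+ (y :* ((con 1 :+ y) :* (s :* t)) :+ con 0 :* t)
    := (con 1 :+ y) :* (con 1 :+ y) :* (s :* t)) ≈-refl s t y

-- Specialisation to s = 1

module _ (R : CommutativeRing c ℓ) where

  open CommutativeRing R hiding (zero) renaming (refl to ≈-refl; sym to ≈-sym; trans to ≈-trans; setoid to ≈-setoid)
  open Polynomials R
  open FiniteSums R using (∑-⊗; ∑-swap; ∑-cong; ∑-*ˡ)
  open SignedPolynomial R
  open PeakPolynomial R
  open Exp semiring using (^-congˡ; ^-congʳ; ^-homo-*)
  open CommutativeExp commutativeSemiring using (^-distrib-*)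
  open AbelianGroupProperties +-abelianGroup using (∙-cancelʳ)
  open Solver commutativeSemiring using (solve; _:+_; _:*_; _:=_; con)
  open import Relation.Binary.Reasoning.Setoid ≈-setoid

  ^-ind : ∀ {p} {P : Set p} x (P? : Dec P) k → x ^ (ind P? ℕ.+ k) ≈ (if does P? then x else 1#) * x ^ k
  ^-ind x P? k with does P?
  ... | true  = ≈-refl
  ... | false = ≈-sym (*-identityˡ _)

  negWeight-^ : ∀ {n} y (w : Fin n → ℤ) → y ^ # (λ i → w i ℤ.<? 0ℤ) ≈ negWeight y w
  negWeight-^ {zero}  y w = ≈-refl
  negWeight-^ {suc n} y w = begin
    y ^ # (λ i → w i ℤ.<? 0ℤ)                                               ≈⟨ ^-congʳ y (#-suc λ i → w i ℤ.<? 0ℤ) ⟩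
    y ^ (ind (w zero ℤ.<? 0ℤ) ℕ.+ # (λ i → w (suc i) ℤ.<? 0ℤ))              ≈⟨ ^-ind y (w zero ℤ.<? 0ℤ) _ ⟩
    (if does (w zero ℤ.<? 0ℤ) then y else 1#) * y ^ # (λ i → w (suc i) ℤ.<? 0ℤ)  ≈⟨ *-congˡ (negWeight-^ y (tail w)) ⟩
    negWeight y w                                                           ∎

  desWeight-^ : ∀ {n} t (v : Fin (suc n) → ℤ) → t ^ # (λ i → v (suc i) ℤ.<? v (inject₁ i)) ≈ desWeight 1# t (v zero) (tail v)
  desWeight-^ {zero}  t v = ≈-refl
  desWeight-^ {suc n} t v = begin
    t ^ # (λ i → v (suc i) ℤ.<? v (inject₁ i))
      ≈⟨ ^-congʳ t (#-suc λ i → v (suc i) ℤ.<? v (inject₁ i)) ⟩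
    t ^ (ind (v (suc zero) ℤ.<? v zero) ℕ.+ # (λ i → v (suc (suc i)) ℤ.<? v (suc (inject₁ i))))
      ≈⟨ ^-ind t (v (suc zero) ℤ.<? v zero) _ ⟩
    step 1# t (v zero) (v (suc zero)) * t ^ # (λ i → v (suc (suc i)) ℤ.<? v (suc (inject₁ i)))
      ≈⟨ *-congˡ (desWeight-^ t (tail v)) ⟩
    desWeight 1# t (v zero) (tail v)  ∎

  B≈L : ∀ n y t → B n y t ≈ L n 1# t y
  B≈L n y t = begin
    B n y t
      ≈⟨ ∑-⊗ (signs-finite n) (𝔖-finite n) (λ (ε , π) → ω (signedPermutation ε π)) ⟩
    ∑ (signs-finite n) (λ ε → ∑ (𝔖-finite n) λ π → ω (signedPermutation ε π))
      ≈⟨ ∑-swap (signs-finite n) (𝔖-finite n) (λ ε π → ω (signedPermutation ε π)) ⟩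
    ∑ (𝔖-finite n) (λ π → ∑ (signs-finite n) λ ε → ω (signedPermutation ε π))
      ≈⟨ ∑-cong (𝔖-finite n) (λ π → ∑-cong (signs-finite n) λ ε →
           *-cong (negWeight-^ y (letters ε π)) (desWeight-^ t (word (signedPermutation ε π)))) ⟩
    L n 1# t y  ∎
    where
    ω : SignedPermutation n → Carrier
    ω σ = y ^ neg σ * t ^ desB σ

  -- With x = ayz each peak supplies one further y and one further z, so y gets the exponent exc π
  -- and z gets n - exc π; then y = bz collects the full power z^n.
  monomial-homogenize : ∀ {n} (π : Permutation′ n) {a b x y z} → a * (y * z) ≈ x → b * z ≈ y →
    monomial x y z (counts π) ≈ z ^ n * (a ^ cpk π * b ^ exc π)
  monomial-homogenize {n} π {a} {b} {x} {y} {z} ayz≈x bz≈y = begin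
    x ^ k * y ^ r * z ^ d
      ≈⟨ *-congʳ (*-congʳ (^-congˡ k (≈-sym ayz≈x))) ⟩
    (a * (y * z)) ^ k * y ^ r * z ^ d
      ≈⟨ *-congʳ (*-congʳ (≈-trans (^-distrib-* a (y * z) k) (*-congˡ (^-distrib-* y z k)))) ⟩
    a ^ k * (y ^ k * z ^ k) * y ^ r * z ^ d
      ≈⟨ solve 5 (λ a y z y′ z′ → a :* (y :* z) :* y′ :* z′ := a :* (y :* y′) :* (z :* z′)) ≈-refl (a ^ k) (y ^ k) (z ^ k) (y ^ r) (z ^ d) ⟩
    a ^ k * (y ^ k * y ^ r) * (z ^ k * z ^ d)
      ≈⟨ *-cong (*-congˡ (^-homo-* y k r)) (^-homo-* z k d) ⟨
    a ^ k * y ^ (k ℕ.+ r) * z ^ (k ℕ.+ d)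
      ≈⟨ *-congʳ (*-congˡ (≈-trans (^-congˡ (k ℕ.+ r) (≈-sym bz≈y)) (^-distrib-* b z (k ℕ.+ r)))) ⟩
    a ^ k * (b ^ (k ℕ.+ r) * z ^ (k ℕ.+ r)) * z ^ (k ℕ.+ d)
      ≈⟨ solve 4 (λ a b z z′ → a :* (b :* z) :* z′ := z :* z′ :* (a :* b)) ≈-refl (a ^ k) (b ^ (k ℕ.+ r)) (z ^ (k ℕ.+ r)) (z ^ (k ℕ.+ d)) ⟩
    z ^ (k ℕ.+ r) * z ^ (k ℕ.+ d) * (a ^ k * b ^ (k ℕ.+ r))
      ≈⟨ *-congʳ (^-homo-* z (k ℕ.+ r) (k ℕ.+ d)) ⟨
    z ^ (k ℕ.+ r ℕ.+ (k ℕ.+ d)) * (a ^ k * b ^ (k ℕ.+ r))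
      ≈⟨ *-cong (^-congʳ z (size-count π)) (*-congˡ (^-congʳ b (exc-count π))) ⟨
    z ^ n * (a ^ k * b ^ exc π)  ∎
    where
    k r d : ℕ
    k = cpk π
    r = count π ↑
    d = count π ↓

  -- Stated without division so that both formulas are instances: the quotients satisfy these
  -- equations by cancellation, and u, v satisfy them with a, b as the given arguments of P.
  B≈P : ∀ n {y t a b} → a * ((y + t) * (1# + y * t)) ≈ (1# + y) ^ 2 * t → b * (1# + y * t) ≈ y + t →
        B n y t ≈ (1# + y * t) ^ n * P n a b
  B≈P n {y} {t} {a} {b} a-eq b-eq = begin
    B n y t
      ≈⟨ B≈L n y t ⟩
    L n 1# t y
      ≈⟨ L≈Q n R 1# t y ⟩
    Q n ((1# + y) * (1# + y) * (1# * t)) (y * 1# + t) (1# + y * t)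
      ≈⟨ Q-cong R n (solve 2 (λ y t → (con 1 :+ y) :* (con 1 :+ y) :* (con 1 :* t) := (con 1 :+ y) :* ((con 1 :+ y) :* con 1) :* t) ≈-refl y t)
                    (+-congʳ (*-identityʳ y)) ≈-refl ⟩
    Q n ((1# + y) ^ 2 * t) (y + t) (1# + y * t)
      ≈⟨ ∑-cong (𝔖-finite n) (λ π → monomial-homogenize π a-eq b-eq) ⟩
    ∑ (𝔖-finite n) (λ π → (1# + y * t) ^ n * (a ^ cpk π * b ^ exc π))
      ≈⟨ ∑-*ˡ (𝔖-finite n) ((1# + y * t) ^ n) (λ π → a ^ cpk π * b ^ exc π) ⟩
    (1# + y * t) ^ n * P n a b  ∎

  -- Solving the substitution for u and v

  /-cancel : ∀ x d ⦃ d-unit : Unit d ⦄ → x / d * d ≈ x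
  /-cancel x d ⦃ d⁻¹ , d⁻¹d≈1 , _ ⦄ = ≈-trans (*-assoc x d⁻¹ d) (≈-trans (*-congˡ d⁻¹d≈1) (*-identityʳ x))

  x-y+y≈x : ∀ x y → x - y + y ≈ x
  x-y+y≈x x y = ≈-trans (+-assoc x (- y) y) (≈-trans (+-congˡ (-‿inverseˡ y)) (+-identityʳ x))

  +⇒- : ∀ {x y z} → x ≈ y + z → x - z ≈ y
  +⇒- {x} {y} {z} x≈y+z = ∙-cancelʳ z (x - z) y (≈-trans (x-y+y≈x x z) x≈y+z)

  -- Both u and v are rational in the root p = (1 + t - √Δ) / 2 of X² - (1 + t) X + yt, whose other root is q:
  -- v = p / q and u = (q - 1) / (1 - p).
  module Substitution (y t √Δ : Carrier) (√Δ²≈Δ : √Δ ^ 2 ≈ (1# + t) ^ 2 - 4# * y * t)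
    ⦃ α-unit : Unit (2# * (1# - y) * t) ⦄ ⦃ β-unit : Unit (2# * y * t) ⦄ where

    private
      α⁻¹ β⁻¹ h p m n q μ κ : Carrier
      α⁻¹ = proj₁ α-unit
      β⁻¹ = proj₁ β-unit
      -- This is 1/2, since `β⁻¹` inverts 2yt.
      h = y * t * β⁻¹
      p = (1# + t - √Δ) * h
      -- With 1 = p + m, t = p + n and q = p + m + n, the identities below become free of
      -- subtraction and fall to the semiring solver.
      m = 1# - p
      n = t - p
      q = p + m + n
      -- `μ` and `κ` turn out to be the inverses of `m` and `q`, because the two denominators equal
      -- 2mn and 2pq.
      μ = 2# * n * α⁻¹
      κ = 2# * p * β⁻¹

    u v : Carrier
    u = (1# + t ^ 2 - 2# * y * t - (1# - t) * √Δ) / (2# * (1# - y) * t)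
    v = ((1# + t) ^ 2 - 2# * y * t - (1# + t) * √Δ) / (2# * y * t)

    private
      2h≈1 : 2# * h ≈ 1#
      2h≈1 = ≈-trans (solve 4 (λ two y t b → two :* (y :* t :* b) := two :* y :* t :* b) ≈-refl 2# y t β⁻¹) (proj₂ (proj₂ β-unit))

      p+m≈1 : p + m ≈ 1#
      p+m≈1 = ≈-trans (+-comm p m) (x-y+y≈x 1# p)

      p+n≈t : p + n ≈ t
      p+n≈t = ≈-trans (+-comm p n) (x-y+y≈x t p)

      √Δ≈m+n : √Δ ≈ m + n
      √Δ≈m+n = ∙-cancelʳ (p + p) √Δ (m + n) (begin
        √Δ + (p + p)                        ≈⟨ solve 3 (λ r d h → r :+ (d :* h :+ d :* h) := (con 1 :+ con 1) :* h :* d :+ r) ≈-refl √Δ (1# + t - √Δ) h ⟩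
        2# * h * (1# + t - √Δ) + √Δ         ≈⟨ +-congʳ (≈-trans (*-congʳ 2h≈1) (*-identityˡ _)) ⟩
        1# + t - √Δ + √Δ                    ≈⟨ x-y+y≈x (1# + t) √Δ ⟩
        1# + t                              ≈⟨ +-cong p+m≈1 p+n≈t ⟨
        p + m + (p + n)                     ≈⟨ solve 3 (λ p m n → p :+ m :+ (p :+ n) := m :+ n :+ (p :+ p)) ≈-refl p m n ⟩
        m + n + (p + p)                     ∎)

      √Δ²≈[m+n]² : √Δ ^ 2 ≈ (m + n) * (m + n)
      √Δ²≈[m+n]² = *-cong √Δ≈m+n (≈-trans (*-identityʳ √Δ) √Δ≈m+n)

      [1+t]²≈ : (1# + t) ^ 2 ≈ (p + m + (p + n)) * (p + m + (p + n))
      [1+t]²≈ = ≈-trans (*-congˡ (*-identityʳ (1# + t))) (≈-sym (*-cong (+-cong p+m≈1 p+n≈t) (+-cong p+m≈1 p+n≈t)))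

      -- As 1 + t = p + q and √Δ = q - p, this is (p + q)² - (q - p)² = 4pq.
      4yt≈4pq : 4# * y * t ≈ 4# * (p * q)
      4yt≈4pq = ∙-cancelʳ (√Δ ^ 2) _ _ (begin
        4# * y * t + √Δ ^ 2                          ≈⟨ +-congˡ √Δ²≈Δ ⟩
        4# * y * t + ((1# + t) ^ 2 - 4# * y * t)     ≈⟨ ≈-trans (+-comm _ _) (x-y+y≈x _ _) ⟩
        (1# + t) ^ 2                                 ≈⟨ [1+t]²≈ ⟩
        (p + m + (p + n)) * (p + m + (p + n))        ≈⟨ solve 3 (λ p m n → (p :+ m :+ (p :+ n)) :* (p :+ m :+ (p :+ n))
                                                          := (con 1 :+ con 1 :+ (con 1 :+ con 1)) :* (p :* (p :+ m :+ n)) :+ (m :+ n) :* (m :+ n)) ≈-refl p m n ⟩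
        4# * (p * q) + (m + n) * (m + n)             ≈⟨ +-congˡ √Δ²≈[m+n]² ⟨
        4# * (p * q) + √Δ ^ 2                        ∎)

      yt≈pq : y * t ≈ p * q
      yt≈pq = begin
        y * t                             ≈⟨ unhalve (y * t) ⟨
        h * h * (4# * (y * t))            ≈⟨ *-congˡ (≈-trans (≈-sym (*-assoc 4# y t)) 4yt≈4pq) ⟩
        h * h * (4# * (p * q))            ≈⟨ unhalve (p * q) ⟩
        p * q                             ∎
        where
        unhalve : ∀ x → h * h * (4# * x) ≈ x
        unhalve x = begin
          h * h * (4# * x)                ≈⟨ solve 2 (λ h x → h :* h :* ((con 1 :+ con 1 :+ (con 1 :+ con 1)) :* x)
                                               := (con 1 :+ con 1) :* h :* ((con 1 :+ con 1) :* h :* x)) ≈-refl h x ⟩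
          2# * h * (2# * h * x)           ≈⟨ *-cong 2h≈1 (*-congʳ 2h≈1) ⟩
          1# * (1# * x)                   ≈⟨ ≈-trans (*-identityˡ _) (*-identityˡ x) ⟩
          x                               ∎

      -- t = (p + m)(p + n) = mn + pq, and pq is yt.
      [1-y]t≈mn : (1# - y) * t ≈ m * n
      [1-y]t≈mn = ∙-cancelʳ (y * t) _ _ (begin
        (1# - y) * t + y * t              ≈⟨ distribʳ t (1# - y) y ⟨
        (1# - y + y) * t                  ≈⟨ *-cong (≈-trans (x-y+y≈x 1# y) (≈-sym p+m≈1)) (≈-sym p+n≈t) ⟩
        (p + m) * (p + n)                 ≈⟨ solve 3 (λ p m n → (p :+ m) :* (p :+ n) := m :* n :+ p :* (p :+ m :+ n)) ≈-refl p m n ⟩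
        m * n + p * q                     ≈⟨ +-congˡ yt≈pq ⟨
        m * n + y * t                     ∎)

      -- A difference of squares: 1 - t = m - n and √Δ = m + n.
      [1-t]√Δ+n²≈m² : (1# - t) * √Δ + n * n ≈ m * m
      [1-t]√Δ+n²≈m² = begin
        d * √Δ + n * n                    ≈⟨ +-congʳ (*-congˡ √Δ≈m+n) ⟩
        d * (m + n) + n * n               ≈⟨ solve 3 (λ d m n → d :* (m :+ n) :+ n :* n := d :* m :+ (d :+ n) :* n) ≈-refl d m n ⟩
        d * m + (d + n) * n               ≈⟨ +-congˡ (*-congʳ d+n≈m) ⟩
        d * m + m * n                     ≈⟨ solve 3 (λ d m n → d :* m :+ m :* n := (d :+ n) :* m) ≈-refl d m n ⟩
        (d + n) * m                       ≈⟨ *-congʳ d+n≈m ⟩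
        m * m                             ∎
        where
        d : Carrier
        d = 1# - t
        d+n≈m : d + n ≈ m
        d+n≈m = ∙-cancelʳ p _ _ (≈-trans (+-assoc d n p) (≈-trans (+-congˡ (x-y+y≈x t p)) (≈-trans (x-y+y≈x 1# t) (≈-sym (x-y+y≈x 1# p)))))

      -- 1 + t² = (p + m)² + (p + n)² = m² + n² + 2pq; subtracting 2yt = 2pq and (1 - t)√Δ = m² - n²
      -- leaves 2n². Division by 2mn then gives u = n/m.
      u-numerator : 1# + t ^ 2 - 2# * y * t - (1# - t) * √Δ ≈ 2# * n * n
      u-numerator = +⇒- (+⇒- (begin
        1# + t ^ 2                                              ≈⟨ +-cong 1≈[p+m]² (*-cong (≈-sym p+n≈t) (≈-trans (*-identityʳ t) (≈-sym p+n≈t))) ⟩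
        (p + m) * (p + m) + (p + n) * (p + n)                   ≈⟨ solve 3 (λ p m n → (p :+ m) :* (p :+ m) :+ (p :+ n) :* (p :+ n)
                                                                     := n :* n :+ m :* m :+ (con 1 :+ con 1) :* (p :* (p :+ m :+ n))) ≈-refl p m n ⟩
        n * n + m * m + 2# * (p * q)                            ≈⟨ +-cong (+-congˡ [1-t]√Δ+n²≈m²) (*-congˡ yt≈pq) ⟨
        n * n + ((1# - t) * √Δ + n * n) + 2# * (y * t)          ≈⟨ solve 4 (λ n d y t → n :* n :+ (d :+ n :* n) :+ (con 1 :+ con 1) :* (y :* t)
                                                                     := (con 1 :+ con 1) :* n :* n :+ d :+ (con 1 :+ con 1) :* y :* t) ≈-refl n ((1# - t) * √Δ) y t ⟩
        2# * n * n + (1# - t) * √Δ + 2# * y * t                 ∎))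
        where
        1≈[p+m]² : 1# ≈ (p + m) * (p + m)
        1≈[p+m]² = ≈-sym (≈-trans (*-cong p+m≈1 p+m≈1) (*-identityˡ 1#))

      -- In terms of the roots this is (p + q)² - 2pq - (p + q)(q - p) = 2p². Division by 2pq then
      -- gives v = p/q.
      v-numerator : (1# + t) ^ 2 - 2# * y * t - (1# + t) * √Δ ≈ 2# * p * p
      v-numerator = +⇒- (+⇒- (begin
        (1# + t) ^ 2                                            ≈⟨ [1+t]²≈ ⟩
        (p + m + (p + n)) * (p + m + (p + n))                   ≈⟨ solve 3 (λ p m n → (p :+ m :+ (p :+ n)) :* (p :+ m :+ (p :+ n))
                                                                     := (con 1 :+ con 1) :* p :* p :+ (p :+ m :+ (p :+ n)) :* (m :+ n) :+ (con 1 :+ con 1) :* (p :* (p :+ m :+ n)))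
                                                                     ≈-refl p m n ⟩
        2# * p * p + (p + m + (p + n)) * (m + n) + 2# * (p * q) ≈⟨ +-cong (+-congˡ (*-cong (≈-sym (+-cong p+m≈1 p+n≈t)) √Δ≈m+n)) (≈-trans (*-assoc 2# y t) (*-congˡ yt≈pq)) ⟨
        2# * p * p + (1# + t) * √Δ + 2# * y * t                 ∎))

      u≈nμ : u ≈ n * μ
      u≈nμ = ≈-trans (*-congʳ u-numerator) (solve 3 (λ two n a → two :* n :* n :* a := n :* (two :* n :* a)) ≈-refl 2# n α⁻¹)

      v≈pκ : v ≈ p * κ
      v≈pκ = ≈-trans (*-congʳ v-numerator) (solve 3 (λ two p b → two :* p :* p :* b := p :* (two :* p :* b)) ≈-refl 2# p β⁻¹)

      μm≈1 : μ * m ≈ 1#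
      μm≈1 = begin
        2# * n * α⁻¹ * m                  ≈⟨ solve 4 (λ two n a m → two :* n :* a :* m := two :* (m :* n) :* a) ≈-refl 2# n α⁻¹ m ⟩
        2# * (m * n) * α⁻¹                ≈⟨ *-congʳ (≈-trans (*-assoc 2# _ t) (*-congˡ [1-y]t≈mn)) ⟨
        2# * (1# - y) * t * α⁻¹           ≈⟨ proj₂ (proj₂ α-unit) ⟩
        1#                                ∎

      κq≈1 : κ * q ≈ 1#
      κq≈1 = begin
        2# * p * β⁻¹ * q                  ≈⟨ solve 4 (λ two p b q → two :* p :* b :* q := two :* (p :* q) :* b) ≈-refl 2# p β⁻¹ q ⟩
        2# * (p * q) * β⁻¹                ≈⟨ *-congʳ (≈-trans (*-assoc 2# y t) (*-congˡ yt≈pq)) ⟨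
        2# * y * t * β⁻¹                  ≈⟨ proj₂ (proj₂ β-unit) ⟩
        1#                                ∎

      -- Over the common denominator mq the numerator is mq + np = (m + n)(p + m), where p + m = 1.
      1+uv≈ : 1# + u * v ≈ μ * κ * (m + n)
      1+uv≈ = begin
        1# + u * v                                      ≈⟨ +-cong (≈-sym (≈-trans (*-cong μm≈1 κq≈1) (*-identityˡ 1#))) (*-cong u≈nμ v≈pκ) ⟩
        μ * m * (κ * q) + n * μ * (p * κ)               ≈⟨ solve 5 (λ μ κ p m n → μ :* m :* (κ :* (p :+ m :+ n)) :+ n :* μ :* (p :* κ)
                                                             := μ :* κ :* (m :+ n) :* (p :+ m)) ≈-refl μ κ p m n ⟩
        μ * κ * (m + n) * (p + m)                       ≈⟨ ≈-trans (*-congˡ p+m≈1) (*-identityʳ _) ⟩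
        μ * κ * (m + n)                                 ∎

      1+u≈ : 1# + u ≈ μ * (m + n)
      1+u≈ = ≈-trans (+-cong (≈-sym μm≈1) u≈nμ) (solve 3 (λ μ m n → μ :* m :+ n :* μ := μ :* (m :+ n)) ≈-refl μ m n)

    -- The numerator of n/m + p/q is nq + pm = (p + n)(m + n), and p + n is t.
    t[1+uv]≈u+v : t * (1# + u * v) ≈ u + v
    t[1+uv]≈u+v = begin
      t * (1# + u * v)                                  ≈⟨ *-cong (≈-sym p+n≈t) 1+uv≈ ⟩
      (p + n) * (μ * κ * (m + n))                       ≈⟨ solve 5 (λ μ κ p m n → (p :+ n) :* (μ :* κ :* (m :+ n))
                                                             := n :* μ :* (κ :* (p :+ m :+ n)) :+ p :* κ :* (μ :* m)) ≈-refl μ κ p m n ⟩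
      n * μ * (κ * q) + p * κ * (μ * m)                 ≈⟨ +-cong (≈-trans (*-congˡ κq≈1) (*-identityʳ _)) (≈-trans (*-congˡ μm≈1) (*-identityʳ _)) ⟩
      n * μ + p * κ                                     ≈⟨ +-cong u≈nμ v≈pκ ⟨
      u + v                                             ∎

    -- Once u + v is replaced by t(1 + uv), the left side is pq((m + n)/(mq))², in which (m + n)/m
    -- is 1 + u and the remaining p/q is v.
    y[u+v][1+uv]≈[1+u]²v : y * ((u + v) * (1# + u * v)) ≈ (1# + u) ^ 2 * v
    y[u+v][1+uv]≈[1+u]²v = begin
      y * ((u + v) * (1# + u * v))                      ≈⟨ *-congˡ (*-congʳ t[1+uv]≈u+v) ⟨
      y * (t * (1# + u * v) * (1# + u * v))             ≈⟨ solve 3 (λ y t z → y :* (t :* z :* z) := y :* t :* (z :* z)) ≈-refl y t (1# + u * v) ⟩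
      y * t * ((1# + u * v) * (1# + u * v))             ≈⟨ *-cong yt≈pq (*-cong 1+uv≈ 1+uv≈) ⟩
      p * q * (μ * κ * (m + n) * (μ * κ * (m + n)))     ≈⟨ solve 5 (λ p q μ κ r → p :* q :* (μ :* κ :* r :* (μ :* κ :* r))
                                                             := μ :* r :* (μ :* r) :* (p :* κ) :* (κ :* q)) ≈-refl p q μ κ (m + n) ⟩
      μ * (m + n) * (μ * (m + n)) * (p * κ) * (κ * q)   ≈⟨ ≈-trans (*-congˡ κq≈1) (*-identityʳ _) ⟩
      μ * (m + n) * (μ * (m + n)) * (p * κ)             ≈⟨ *-cong (*-cong 1+u≈ (≈-trans (*-identityʳ _) 1+u≈)) v≈pκ ⟨
      (1# + u) ^ 2 * v                                  ∎

theorem3p16 :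
    ∀ {c ℓ} (R : CommutativeRing c ℓ) (n : ℕ) → n ≥ 1 →
    let open CommutativeRing R
        open Polynomials R
    in
    ( ∀ (y t : Carrier) ⦃ _ : Unit ((y + t) * (1# + y * t)) ⦄ ⦃ _ : Unit (1# + y * t) ⦄ →
      B n y t ≈ (1# + y * t) ^ n * P n ((1# + y) ^ 2 * t / ((y + t) * (1# + y * t))) ((y + t) / (1# + y * t))
    ) ×
    ( ∀ (y t √Δ : Carrier) → √Δ ^ 2 ≈ (1# + t) ^ 2 - 4# * y * t →
      ∀ ⦃ _ : Unit (2# * (1# - y) * t) ⦄ ⦃ _ : Unit (2# * y * t) ⦄ →
      let u = (1# + t ^ 2 - 2# * y * t - (1# - t) * √Δ) / (2# * (1# - y) * t)
          v = ((1# + t) ^ 2 - 2# * y * t - (1# + t) * √Δ) / (2# * y * t)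
      in
      ∀ ⦃ _ : Unit ((1# + u * v) ^ n) ⦄ →
      P n y t ≈ 1# / (1# + u * v) ^ n * B n u v
    )
theorem3p16 R n _ = direct , inverse
  where
  open CommutativeRing R renaming (sym to ≈-sym)
  open Polynomials R
  open import Relation.Binary.Reasoning.Setoid (CommutativeRing.setoid R)

  direct : ∀ (y t : Carrier) ⦃ _ : Unit ((y + t) * (1# + y * t)) ⦄ ⦃ _ : Unit (1# + y * t) ⦄ →
    B n y t ≈ (1# + y * t) ^ n * P n ((1# + y) ^ 2 * t / ((y + t) * (1# + y * t))) ((y + t) / (1# + y * t))
  direct y t = B≈P R n (/-cancel R _ ((y + t) * (1# + y * t))) (/-cancel R _ (1# + y * t))

  inverse : ∀ (y t √Δ : Carrier) (√Δ²≈Δ : √Δ ^ 2 ≈ (1# + t) ^ 2 - 4# * y * t)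
    ⦃ _ : Unit (2# * (1# - y) * t) ⦄ ⦃ _ : Unit (2# * y * t) ⦄ →
    let open Substitution R y t √Δ √Δ²≈Δ in
    ⦃ _ : Unit ((1# + u * v) ^ n) ⦄ → P n y t ≈ 1# / (1# + u * v) ^ n * B n u v
  inverse y t √Δ √Δ²≈Δ = begin
    P n y t                                      ≈⟨ *-identityˡ _ ⟨
    1# * P n y t                                 ≈⟨ *-congʳ (/-cancel R 1# ((1# + u * v) ^ n)) ⟨
    1# / (1# + u * v) ^ n * (1# + u * v) ^ n * P n y t    ≈⟨ *-assoc _ _ _ ⟩
    1# / (1# + u * v) ^ n * ((1# + u * v) ^ n * P n y t)  ≈⟨ *-congˡ (B≈P R n y[u+v][1+uv]≈[1+u]²v t[1+uv]≈u+v) ⟨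
    1# / (1# + u * v) ^ n * B n u v              ∎
    where open Substitution R y t √Δ √Δ²≈Δ
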